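{- For every integer $n\ge1$, $$V_n(10)=\begin{cases}6\cdot5^{n/2}\left[(2\cdot15^n+12^n+2\cdot60^n)L_n+60^nL_{5n}\right], & n\text{ even},\\[2mm] 6\cdot5^{(n+1)/2}\left[(2\cdot15^n+12^n+2\cdot60^n)F_n+60^nF_{5n}\right], & n\text{ odd}.\end{cases}$$
   Context: For integers $n\ge1$, $m\ge3$, the $\mathrm{SU}(3)$ Verlinde sum is $$V_n(m)=3^nm^{2n}\sum_{\substack{(j,\ell,k)\in(\mathbb Z/m\mathbb Z\setminus\{0\})^3\\ j+\ell+k\equiv 0 \bmod m}}\Big(8\sin\frac{\pi j}{m}\sin\frac{\pi\ell}{m}\sin\frac{\pi k}{m}\Big)^{ -2n}.$$ $F_n$ is the $n$th Fibonacci number ($F_1=F_2=1$, $F_{n+1}=F_n+F_{n-1}$) and $L_n$ is the $n$th Lucas number ($L_1=1$, $L_2=3$, $L_{n+1}=L_n+L_{n-1}$). -}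

module Defs where

open import Algebra.Apartness.Bundles using (HeytingField; HeytingCommutativeRing)
open import Algebra.Bundles using (CommutativeRing; Semiring)
import Algebra.Definitions.RawSemiring as RawSemiringDefinitions
import Algebra.Properties.Ring as RingProperties
import Algebra.Properties.Semiring.Mult as SemiringMult
open import Data.Bool.Base using (if_then_else_)
open import Data.Empty using (⊥-elim)
open import Data.Fin.Base using (Fin; toℕ)
open import Data.Fin.Properties using (toℕ<n)
open import Data.Nat.Base as ℕ using (ℕ; zero; suc; NonZero; _!)
open import Data.Nat.Divisibility using (_∣?_)
import Data.Nat.Properties as ℕ
open import Data.Product.Base using (∃; _×_; _,_; proj₁; proj₂)
open import Data.Sum.Base using (_⊎_; inj₁; inj₂)
open import Level using (Level; _⊔_) renaming (suc to lsuc)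
open import Relation.Binary.Core using (Rel)
import Relation.Binary.Reasoning.Setoid as SetoidReasoning
open import Relation.Binary.Structures using (IsStrictPartialOrder)
open import Relation.Nullary.Decidable.Core using (does)

F : ℕ → ℕ
F 0             = 0
F 1             = 1
F (suc (suc n)) = F (suc n) ℕ.+ F n

L : ℕ → ℕ
L 0             = 2
L 1             = 1
L (suc (suc n)) = L (suc n) ℕ.+ L n

private variable
  c ℓ₁ ℓ₂ ℓ₃ : Level

module Sequences (K : HeytingField c ℓ₁ ℓ₂) (_<_ : Rel (HeytingField.Carrier K) ℓ₃) where

  open HeytingField K

  IsCauchy : (ℕ → Carrier) → Set (c ⊔ ℓ₃)
  IsCauchy f = ∀ ε → 0# < ε → ∃ λ N → ∀ i j → N ℕ.≤ i → N ℕ.≤ j → f i < (f j + ε)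

  _ConvergesTo_ : (ℕ → Carrier) → Carrier → Set (c ⊔ ℓ₃)
  f ConvergesTo l =
    ∀ ε → 0# < ε → ∃ λ N → ∀ i → N ℕ.≤ i → ((l - ε) < f i) × (f i < (l + ε))

-- The real numbers, as an Archimedean, Cauchy-complete ordered field.
-- Classically these axioms determine ℝ up to unique isomorphism.  The inverse
-- is partial (on elements apart from 0) and the order is not assumed
-- decidable, so that constructions of ℝ without excluded middle are models too.
record RealNumbers c ℓ₁ ℓ₂ ℓ₃ : Set (lsuc (c ⊔ ℓ₁ ⊔ ℓ₂ ⊔ ℓ₃)) where
  infix 4 _<_
  field
    heytingField : HeytingField c ℓ₁ ℓ₂

  open HeytingField heytingField public

  commutativeRing : CommutativeRing c ℓ₁
  commutativeRing = HeytingCommutativeRing.commutativeRing heytingCommutativeRing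

  open CommutativeRing commutativeRing public using (ring; semiring)
  open RawSemiringDefinitions (Semiring.rawSemiring semiring) public using (_^_; sum) renaming (_×_ to _·_)

  fromℕ : ℕ → Carrier
  fromℕ n = n · 1#

  field
    _<_                  : Rel Carrier ℓ₃
    isStrictPartialOrder : IsStrictPartialOrder _≈_ _<_
    #⇒<                  : ∀ {x y} → x # y → x < y ⊎ y < x
    <⇒#                  : ∀ {x y} → x < y → x # y
    +-monoˡ-<            : ∀ z {x y} → x < y → x + z < y + z
    *-pos                : ∀ {x y} → 0# < x → 0# < y → 0# < x * y

  open Sequences heytingField _<_ public

  field
    archimedean : ∀ x → ∃ λ n → x < fromℕ n
    complete    : ∀ f → IsCauchy f → ∃ λ l → f ConvergesTo l

module RealProperties (ℝ : RealNumbers c ℓ₁ ℓ₂ ℓ₃) where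

  open RealNumbers ℝ
  open IsStrictPartialOrder isStrictPartialOrder public
    using (<-respʳ-≈; <-respˡ-≈) renaming (trans to <-trans; irrefl to <-irrefl)
  open RingProperties ring
  open SemiringMult semiring using (×-homo-+; ×-congˡ)

  _⁻¹[_] : ∀ x → 0# < x → Carrier
  x ⁻¹[ 0<x ] = proj₁ (#⇒invertible (#-sym (<⇒# 0<x)))

  x-0≈x : ∀ x → x - 0# ≈ x
  x-0≈x x = trans (+-congˡ -0#≈0#) (+-identityʳ x)

  *-⁻¹ : ∀ x (0<x : 0# < x) → x * x ⁻¹[ 0<x ] ≈ 1#
  *-⁻¹ x 0<x =
    trans (*-congʳ (sym (x-0≈x x))) (proj₂ (proj₂ (#⇒invertible (#-sym (<⇒# 0<x)))))

  neg-pos : ∀ {x} → x < 0# → 0# < - x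
  neg-pos {x} x<0 =
    <-respˡ-≈ (-‿inverseʳ x) (<-respʳ-≈ (+-identityˡ _) (+-monoˡ-< (- x) x<0))

  0<1 : 0# < 1#
  0<1 with #⇒< (invertible⇒# {1#} {0#} (1# ,
             trans (*-identityˡ _) (x-0≈x 1#) , trans (*-identityʳ _) (x-0≈x 1#)))
  ... | inj₂ 0<1 = 0<1
  ... | inj₁ 1<0 = <-respʳ-≈ -1*-1≈1 (*-pos (neg-pos 1<0) (neg-pos 1<0))
    where
    -1*-1≈1 : - 1# * - 1# ≈ 1#
    -1*-1≈1 = trans (-1*x≈-x (- 1#)) (-‿involutive 1#)

  +-pos : ∀ {x y} → 0# < x → 0# < y → 0# < x + y
  +-pos {y = y} 0<x 0<y =
    <-trans 0<y (<-respˡ-≈ (+-identityˡ y) (+-monoˡ-< y 0<x))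

  fromℕ-pos : ∀ n → .{{NonZero n}} → 0# < fromℕ n
  fromℕ-pos (suc zero)    = <-respʳ-≈ (sym (+-identityʳ 1#)) 0<1
  fromℕ-pos (suc (suc n)) = +-pos 0<1 (fromℕ-pos (suc n))

  ⁻¹-pos : ∀ x (0<x : 0# < x) → 0# < x ⁻¹[ 0<x ]
  ⁻¹-pos x 0<x with #⇒< (invertible⇒# {x ⁻¹[ 0<x ]} {0#} (x ,
                      trans (*-congˡ (x-0≈x _)) (*-⁻¹ x 0<x) ,
                      trans (*-congʳ (x-0≈x _)) (trans (*-comm _ x) (*-⁻¹ x 0<x))))
  ... | inj₂ pos = pos
  ... | inj₁ neg = ⊥-elim (<-irrefl refl (<-trans 0<1 1<0))
    where
    0<-1 : 0# < - 1#
    0<-1 = <-respʳ-≈ (trans (sym (-‿distribʳ-* x _)) (-‿cong (*-⁻¹ x 0<x)))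
             (*-pos 0<x (neg-pos neg))
    1<0 : 1# < 0#
    1<0 = <-respˡ-≈ (+-identityˡ 1#) (<-respʳ-≈ (-‿inverseˡ 1#) (+-monoˡ-< 1# 0<-1))

  recip : ∀ n → .{{NonZero n}} → Carrier
  recip n = fromℕ n ⁻¹[ fromℕ-pos n ]

  fromℕ-mono-< : ∀ {i n} → i ℕ.< n → fromℕ i < fromℕ n
  fromℕ-mono-< {i} {n} i<n =
    <-respˡ-≈ (+-identityˡ _) (<-respʳ-≈ eq (+-monoˡ-< (fromℕ i) (fromℕ-pos (n ℕ.∸ i))))
    where
    instance
      _ : NonZero (n ℕ.∸ i)
      _ = ℕ.>-nonZero (ℕ.m<n⇒0<n∸m i<n)
    eq : fromℕ (n ℕ.∸ i) + fromℕ i ≈ fromℕ n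
    eq = trans (sym (×-homo-+ 1# (n ℕ.∸ i) i)) (×-congˡ (ℕ.m∸n+n≡m (ℕ.<⇒≤ i<n)))

  *-monoˡ-< : ∀ {x y z} → 0# < z → x < y → z * x < z * y
  *-monoˡ-< {x} {y} {z} 0<z x<y =
    <-respˡ-≈ (+-identityˡ _) (<-respʳ-≈ eq (+-monoˡ-< (z * x) (*-pos 0<z 0<y-x)))
    where
    0<y-x : 0# < y - x
    0<y-x = <-respˡ-≈ (-‿inverseʳ x) (+-monoˡ-< (- x) x<y)
    open SetoidReasoning (CommutativeRing.setoid commutativeRing)
    eq : z * (y - x) + z * x ≈ z * y
    eq = begin
      z * (y - x) + z * x  ≈⟨ distribˡ z (y - x) x ⟨
      z * (y - x + x)      ≈⟨ *-congˡ (+-assoc y (- x) x) ⟩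
      z * (y + (- x + x))  ≈⟨ *-congˡ (+-congˡ (-‿inverseˡ x)) ⟩
      z * (y + 0#)         ≈⟨ *-congˡ (+-identityʳ y) ⟩
      z * y                ∎

module Sine (ℝ : RealNumbers c ℓ₁ ℓ₂ ℓ₃) where

  open RealNumbers ℝ
  open RealProperties ℝ

  sineTerm : Carrier → ℕ → Carrier
  sineTerm x k =
    (- 1#) ^ k * x ^ (2 ℕ.* k ℕ.+ 1) *
    recip ((2 ℕ.* k ℕ.+ 1) !) {{ℕ._!≢0 (2 ℕ.* k ℕ.+ 1)}}

  sinePartialSum : Carrier → ℕ → Carrier
  sinePartialSum x N = sum {N} λ k → sineTerm x (toℕ k)

  IsSine : (Carrier → Carrier) → Set (c ⊔ ℓ₃)
  IsSine sin = ∀ x → sinePartialSum x ConvergesTo sin x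

  -- π is the smallest positive zero of the sine.  Positivity of sin on (0 , π),
  -- rather than mere nonvanishing, costs nothing (intermediate value theorem)
  -- and keeps the condition constructively meaningful.
  record IsPi (sin : Carrier → Carrier) (π : Carrier) : Set (c ⊔ ℓ₁ ⊔ ℓ₃) where
    field
      π-pos   : 0# < π
      sin-π   : sin π ≈ 0#
      sin-pos : ∀ x → 0# < x → x < π → 0# < sin x

open Sine public using (IsSine; IsPi)

module Verlinde (ℝ : RealNumbers c ℓ₁ ℓ₂ ℓ₃)
                (sin : RealNumbers.Carrier ℝ → RealNumbers.Carrier ℝ)
                (π : RealNumbers.Carrier ℝ)
                (isPi : IsPi ℝ sin π) where

  open RealNumbers ℝ
  open RealProperties ℝ
  open IsPi isPi

  -- Fin (ℕ.pred m) indexes the nonzero residues mod m by their representatives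
  -- 1 , … , m - 1.  The summand below depends only on residues: changing a
  -- representative by m only flips the sign of a sine, and exponents are even.
  rep : ∀ {p} → Fin p → ℕ
  rep j = suc (toℕ j)

  rep<m : ∀ m .{{_ : NonZero m}} (j : Fin (ℕ.pred m)) → rep j ℕ.< m
  rep<m (suc p) j = ℕ.s≤s (toℕ<n j)

  module _ (m : ℕ) .{{_ : NonZero m}} where

    angle : Fin (ℕ.pred m) → Carrier
    angle j = π * (fromℕ (rep j) * recip m)

    angle-pos : ∀ j → 0# < angle j
    angle-pos j = *-pos π-pos (*-pos (fromℕ-pos (rep j)) (⁻¹-pos _ (fromℕ-pos m)))

    angle<π : ∀ j → angle j < π
    angle<π j = <-respʳ-≈ (*-identityʳ π) (*-monoˡ-< π-pos
      (<-respˡ-≈ (*-comm _ _) (<-respʳ-≈ (trans (*-comm _ _) (*-⁻¹ _ (fromℕ-pos m)))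
        (*-monoˡ-< (⁻¹-pos _ (fromℕ-pos m)) (fromℕ-mono-< (rep<m m j))))))

    s : Fin (ℕ.pred m) → Carrier
    s j = sin (angle j)

    s-pos : ∀ j → 0# < s j
    s-pos j = sin-pos (angle j) (angle-pos j) (angle<π j)

    sineProduct : (j ℓ k : Fin (ℕ.pred m)) → Carrier
    sineProduct j ℓ k = fromℕ 8 * s j * s ℓ * s k

    sineProduct-pos : ∀ j ℓ k → 0# < sineProduct j ℓ k
    sineProduct-pos j ℓ k =
      *-pos (*-pos (*-pos (fromℕ-pos 8) (s-pos j)) (s-pos ℓ)) (s-pos k)

  V : (n m : ℕ) → .{{NonZero m}} → Carrier
  V n m = fromℕ (3 ℕ.^ n ℕ.* m ℕ.^ (2 ℕ.* n)) *
    sum λ j → sum λ ℓ → sum λ k →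
      if does (m ∣? rep j ℕ.+ rep ℓ ℕ.+ rep k)
      then (sineProduct m j ℓ k ⁻¹[ sineProduct-pos m j ℓ k ]) ^ (2 ℕ.* n)
      else 0#

module Submission where

-- The exponential series in ℂ converges geometrically, so its Cauchy product yields
-- exp (z + w) = exp z · exp w, and with x + i y = exp (i π / 10) the sine of n π / 10 is the
-- imaginary part of (x + i y)ⁿ.  Here x² + y² = 1, and 0 = sin π = 2 sin (π / 2) cos (π / 2)
-- forces cos (π / 2) = 0, hence φ² = φ + 1 for φ = 2 cos (π / 5) = 2 (x² - y²).  Thus every
-- 4 sin² (n π / 10) lies in ℤ[φ], and each of the 72 terms of V n 10 becomes, after multiplication
-- by 300ⁿ, the n-th power of one of eight elements of ℤ[φ].  These come in conjugate pairs
-- m √5 φᵉ, - m √5 ψᵉ with e = 1 or 5, and Binet's formulas evaluate the pair sums.  Only φ² = φ + 1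
-- is used, never which of the two roots φ is, because the pairs are conjugation invariant.

open import Defs
open import Algebra.Bundles using (AbelianGroup; CommutativeRing)
import Algebra.Construct.DirectProduct as DirectProduct
import Algebra.Properties.AbelianGroup as AbelianGroupProperties
import Algebra.Properties.CommutativeMonoid.Mult as CommutativeMonoidMult
import Algebra.Properties.CommutativeMonoid.Sum as CommutativeMonoidSum
import Algebra.Properties.CommutativeSemigroup as CommutativeSemigroupProperties
import Algebra.Properties.CommutativeSemiring.Exp as CommutativeSemiringExp
import Algebra.Properties.Ring as RingProperties
import Algebra.Properties.Semiring.Exp as SemiringExp
import Algebra.Properties.Semiring.Mult as SemiringMult
import Algebra.Properties.Semiring.Mult.TCOptimised as SemiringMultTC
import Algebra.Solver.Ring as RingSolver
open import Algebra.Solver.Ring.AlmostCommutativeRing using (fromCommutativeRing; _-Raw-AlmostCommutative⟶_)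
open import Algebra.Structures using (IsCommutativeRing)
open import Data.Bool.Base using (Bool; if_then_else_)
open import Data.Empty using (⊥-elim)
open import Data.Fin.Base as Fin using (Fin; toℕ)
open import Data.Fin.Patterns using (0F; 1F; 2F; 3F; 4F; 5F; 6F; 7F)
open import Data.Fin.Properties using (all?)
open import Data.Integer.Base as ℤ using (ℤ; +_; -[1+_])
import Data.Integer.Properties as ℤ
import Data.Maybe.Base as Maybe
open import Data.Nat.Base as ℕ using (ℕ; zero; suc; NonZero; _!)
open import Data.Nat.Divisibility using (_∣_; _∤_; _∣?_; m∣m*n; ∣m+n∣m⇒∣n; ∣1⇒≡1)
import Data.Nat.DivMod as ℕ
import Data.Nat.Properties as ℕ
open import Data.Nat.Tactic.RingSolver using (solve-∀)
open import Data.Product.Base using (∃; _×_; _,_; proj₁; proj₂)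
open import Data.Product.Properties using (≡-dec)
open import Data.Sum.Base using (_⊎_; inj₁; inj₂)
open import Data.Vec.Base using (_∷_; []; lookup)
import Data.Vec.Functional as Vector
open import Function.Base using (_∘_; case_of_)
open import Level using (Level; _⊔_) renaming (suc to lsuc)
import Relation.Binary.PropositionalEquality.Core as ≡
open ≡ using (_≡_)
import Relation.Binary.Reasoning.Setoid as SetoidReasoning
open import Relation.Nullary.Decidable.Core using (Dec; does; yes; no; toWitness; _→-dec_; dec⇒maybe)
open import Relation.Nullary.Negation.Core using (¬_)

-- The obstacle is analytic. The order on ℝ is undecidable, so signs admit no case distinction, and
-- sizes occur only through relations saying "bounded by r". Of trigonometry only the sine is given,
-- as a limit without a rate. Every estimate is therefore brought to the form K ½ⁿ: such bounds
-- survive sums and Cauchy products, the given limits are shown to obey them, and a number bounded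
-- by K ½ⁿ for all n is 0. The cosine has to be produced by completeness.
--
-- Little passes from analysis to algebra: the sines of n π / 10 are imaginary parts of powers of
-- one unit complex number, they are positive for 0 < n < 10, and sin π = 0. The rest is exact
-- integer arithmetic. The constant 300 = 3 · 10² absorbs the prefactor 3ⁿ 10²ⁿ, and nothing is
-- inverted in ℤ[φ]: a candidate b for a summand is tested by multiplying b with the three factors 4
-- sin² and comparing with 300. Conjugate pairs appear because multiplication by 3 modulo 10
-- permutes the triples and acts on the numbers 4 sin² (j π / 10) as the conjugation of ℤ[φ].

private variable
  c ℓ ℓ₁ ℓ₂ ℓ₃ : Level

-- Polynomial identities with integer coefficients in a commutative ring.

module IntegerCoefficients (R : CommutativeRing c ℓ) where

  open CommutativeRing R
  open RingProperties ring
  open AbelianGroupProperties +-abelianGroup using (⁻¹-∙-comm)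
  open CommutativeSemigroupProperties +-commutativeSemigroup using (interchange)
  open SemiringMultTC semiring renaming (_×_ to _×′_)
  open SetoidReasoning setoid

  -- With the optimised multiple, `fromℤ (+ 1)` computes to `1#` and `fromℤ (+ 2)` to `1# + 1#`, so
  -- that solved identities match ring expressions without correction terms.
  fromℤ : ℤ → Carrier
  fromℤ (+ n)    = n ×′ 1#
  fromℤ -[1+ n ] = - (suc n ×′ 1#)

  fromℤ-⊖ : ∀ m n → fromℤ (m ℤ.⊖ n) ≈ m ×′ 1# - n ×′ 1#
  fromℤ-⊖ m       zero    = sym (trans (+-congˡ -0#≈0#) (+-identityʳ _))
  fromℤ-⊖ zero    (suc n) = sym (+-identityˡ _)
  fromℤ-⊖ (suc m) (suc n) = begin
    fromℤ (suc m ℤ.⊖ suc n)              ≡⟨ ≡.cong fromℤ (ℤ.[1+m]⊖[1+n]≡m⊖n m n) ⟩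
    fromℤ (m ℤ.⊖ n)                      ≈⟨ fromℤ-⊖ m n ⟩
    m ×′ 1# - n ×′ 1#                    ≈⟨ +-identityˡ _ ⟨
    0# + (m ×′ 1# - n ×′ 1#)             ≈⟨ +-congʳ (-‿inverseʳ 1#) ⟨
    (1# - 1#) + (m ×′ 1# - n ×′ 1#)      ≈⟨ interchange _ _ _ _ ⟩
    (1# + m ×′ 1#) + (- 1# - n ×′ 1#)    ≈⟨ +-congˡ (⁻¹-∙-comm _ _) ⟩
    (1# + m ×′ 1#) - (1# + n ×′ 1#)      ≈⟨ +-cong (1+× m 1#) (-‿cong (1+× n 1#)) ⟨
    suc m ×′ 1# - suc n ×′ 1#            ∎

  fromℤ-‿homo : ∀ i → fromℤ (ℤ.- i) ≈ - fromℤ i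
  fromℤ-‿homo (+ zero)  = sym -0#≈0#
  fromℤ-‿homo (+ suc n) = refl
  fromℤ-‿homo -[1+ n ]  = sym (-‿involutive _)

  fromℤ-+-homo : ∀ i j → fromℤ (i ℤ.+ j) ≈ fromℤ i + fromℤ j
  fromℤ-+-homo (+ m)    (+ n)    = ×-homo-+ 1# m n
  fromℤ-+-homo (+ m)    -[1+ n ] = fromℤ-⊖ m (suc n)
  fromℤ-+-homo -[1+ m ] (+ n)    = trans (fromℤ-⊖ n (suc m)) (+-comm _ _)
  fromℤ-+-homo -[1+ m ] -[1+ n ] = begin
    - (suc (suc (m ℕ.+ n)) ×′ 1#)        ≡⟨ ≡.cong (λ k → - (suc k ×′ 1#)) (ℕ.+-suc m n) ⟨
    - ((suc m ℕ.+ suc n) ×′ 1#)          ≈⟨ -‿cong (×-homo-+ 1# (suc m) (suc n)) ⟩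
    - (suc m ×′ 1# + suc n ×′ 1#)        ≈⟨ ⁻¹-∙-comm _ _ ⟨
    - (suc m ×′ 1#) - suc n ×′ 1#        ∎

  fromℤ-*-+homo : ∀ m j → fromℤ (+ m ℤ.* j) ≈ fromℤ (+ m) * fromℤ j
  fromℤ-*-+homo m (+ n)    = trans (reflexive (≡.cong fromℤ (≡.sym (ℤ.pos-* m n)))) (×1-homo-* m n)
  fromℤ-*-+homo m -[1+ n ] = begin
    fromℤ (+ m ℤ.* ℤ.- + suc n)          ≡⟨ ≡.cong fromℤ (ℤ.neg-distribʳ-* (+ m) (+ suc n)) ⟨
    fromℤ (ℤ.- (+ m ℤ.* + suc n))        ≈⟨ fromℤ-‿homo (+ m ℤ.* + suc n) ⟩
    - fromℤ (+ m ℤ.* + suc n)            ≈⟨ -‿cong (fromℤ-*-+homo m (+ suc n)) ⟩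
    - (m ×′ 1# * suc n ×′ 1#)            ≈⟨ -‿distribʳ-* _ _ ⟩
    m ×′ 1# * - (suc n ×′ 1#)            ∎

  fromℤ-*-homo : ∀ i j → fromℤ (i ℤ.* j) ≈ fromℤ i * fromℤ j
  fromℤ-*-homo (+ m)    j = fromℤ-*-+homo m j
  fromℤ-*-homo -[1+ m ] j = begin
    fromℤ (ℤ.- (+ suc m) ℤ.* j)          ≡⟨ ≡.cong fromℤ (ℤ.neg-distribˡ-* (+ suc m) j) ⟨
    fromℤ (ℤ.- (+ suc m ℤ.* j))          ≈⟨ fromℤ-‿homo (+ suc m ℤ.* j) ⟩
    - fromℤ (+ suc m ℤ.* j)              ≈⟨ -‿cong (fromℤ-*-+homo (suc m) j) ⟩
    - (suc m ×′ 1# * fromℤ j)            ≈⟨ -‿distribˡ-* _ _ ⟩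
    - (suc m ×′ 1#) * fromℤ j            ∎

  fromℤ-morphism : ℤ.+-*-rawRing -Raw-AlmostCommutative⟶ fromCommutativeRing R
  fromℤ-morphism = record
    { ⟦_⟧    = fromℤ
    ; +-homo = fromℤ-+-homo
    ; *-homo = fromℤ-*-homo
    ; -‿homo = fromℤ-‿homo
    ; 0-homo = refl
    ; 1-homo = refl
    }

  -- Coefficients are compared in ℤ, so terms cancel during normalisation although equality in `R`
  -- is undecidable.
  open RingSolver ℤ.+-*-rawRing (fromCommutativeRing R) fromℤ-morphism
    (λ i j → Maybe.map (λ i≡j → reflexive (≡.cong fromℤ i≡j)) (dec⇒maybe (i ℤ.≟ j)))
    public using (solve; con; _:+_; _:*_; _:-_; :-_; _:^_; _:=_)

-- Cauchy products and formal derivatives of coefficient sequences.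

module PowerSeries (R : CommutativeRing c ℓ) where

  open CommutativeRing R
  open IntegerCoefficients R
  open SemiringMult semiring using (×-comm-*) renaming (_×_ to _·_)
  open CommutativeMonoidMult +-commutativeMonoid using (×-distrib-+)
  open CommutativeSemigroupProperties +-commutativeSemigroup using (interchange)
  open SetoidReasoning setoid

  infix 4 _≋_
  _≋_ : (f g : ℕ → Carrier) → Set _
  f ≋ g = ∀ k → f k ≈ g k

  Σ< : ℕ → (ℕ → Carrier) → Carrier
  Σ< zero    f = 0#
  Σ< (suc n) f = f 0 + Σ< n (f ∘ suc)

  Σ<-cong : ∀ n {f g} → f ≋ g → Σ< n f ≈ Σ< n g
  Σ<-cong zero    f≋g = refl
  Σ<-cong (suc n) f≋g = +-cong (f≋g 0) (Σ<-cong n (f≋g ∘ suc))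

  Σ<-+ : ∀ n f g → Σ< n (λ k → f k + g k) ≈ Σ< n f + Σ< n g
  Σ<-+ zero    f g = sym (+-identityˡ 0#)
  Σ<-+ (suc n) f g = trans (+-congˡ (Σ<-+ n (f ∘ suc) (g ∘ suc))) (interchange _ _ _ _)

  Σ<-*ˡ : ∀ n x f → Σ< n (λ k → x * f k) ≈ x * Σ< n f
  Σ<-*ˡ zero    x f = sym (zeroʳ x)
  Σ<-*ˡ (suc n) x f = trans (+-congˡ (Σ<-*ˡ n x (f ∘ suc))) (sym (distribˡ _ _ _))

  Σ<-0 : ∀ n → Σ< n (λ _ → 0#) ≈ 0#
  Σ<-0 zero    = refl
  Σ<-0 (suc n) = trans (+-identityˡ _) (Σ<-0 n)

  infixl 7 _⋆_
  -- The Cauchy product, with k-th entry the sum of f i · g (k - i) over i ≤ k. Recursion on the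
  -- head of `f` avoids subtracting indices.
  _⋆_ : (f g : ℕ → Carrier) → ℕ → Carrier
  (f ⋆ g) zero    = f 0 * g 0
  (f ⋆ g) (suc k) = f 0 * g (suc k) + (f ∘ suc ⋆ g) k

  ⋆-cong : ∀ {f f′ g g′} → f ≋ f′ → g ≋ g′ → f ⋆ g ≋ f′ ⋆ g′
  ⋆-cong f≋f′ g≋g′ zero    = *-cong (f≋f′ 0) (g≋g′ 0)
  ⋆-cong f≋f′ g≋g′ (suc k) = +-cong (*-cong (f≋f′ 0) (g≋g′ _)) (⋆-cong (f≋f′ ∘ suc) g≋g′ k)

  ⋆-distribʳ : ∀ f f′ g k → ((λ i → f i + f′ i) ⋆ g) k ≈ (f ⋆ g) k + (f′ ⋆ g) k
  ⋆-distribʳ f f′ g zero    = distribʳ _ _ _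
  ⋆-distribʳ f f′ g (suc k) =
    trans (+-cong (distribʳ _ _ _) (⋆-distribʳ (f ∘ suc) (f′ ∘ suc) g k)) (interchange _ _ _ _)

  ⋆-*ˡ : ∀ x f g k → ((λ i → x * f i) ⋆ g) k ≈ x * (f ⋆ g) k
  ⋆-*ˡ x f g zero    = *-assoc _ _ _
  ⋆-*ˡ x f g (suc k) = trans (+-cong (*-assoc _ _ _) (⋆-*ˡ x (f ∘ suc) g k)) (sym (distribˡ _ _ _))

  ⋆-*ʳ : ∀ x f g k → (f ⋆ (λ i → x * g i)) k ≈ x * (f ⋆ g) k
  ⋆-*ʳ x f g zero    = solve 3 (λ x y z → y :* (x :* z) := x :* (y :* z)) refl x _ _
  ⋆-*ʳ x f g (suc k) = begin
    f 0 * (x * g (suc k)) + (f ∘ suc ⋆ (λ i → x * g i)) k  ≈⟨ +-congˡ (⋆-*ʳ x (f ∘ suc) g k) ⟩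
    f 0 * (x * g (suc k)) + x * (f ∘ suc ⋆ g) k
      ≈⟨ solve 4 (λ x y z w → y :* (x :* z) :+ x :* w := x :* (y :* z :+ w)) refl x _ _ _ ⟩
    x * (f 0 * g (suc k) + (f ∘ suc ⋆ g) k)                ∎

  -- The triangle i + j ≤ n consists of the row i = 0 and a smaller triangle.
  Σ<-⋆ : ∀ f g n → Σ< (suc n) (f ⋆ g) ≈ f 0 * Σ< (suc n) g + Σ< n (f ∘ suc ⋆ g)
  Σ<-⋆ f g n = begin
    f 0 * g 0 + Σ< n (λ k → f 0 * g (suc k) + (f ∘ suc ⋆ g) k)
      ≈⟨ +-congˡ (Σ<-+ n _ _) ⟩
    f 0 * g 0 + (Σ< n (λ k → f 0 * g (suc k)) + Σ< n (f ∘ suc ⋆ g))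
      ≈⟨ +-congˡ (+-congʳ (Σ<-*ˡ n (f 0) (g ∘ suc))) ⟩
    f 0 * g 0 + (f 0 * Σ< n (g ∘ suc) + Σ< n (f ∘ suc ⋆ g))
      ≈⟨ solve 4 (λ x y z w → x :* y :+ (x :* z :+ w) := x :* (y :+ z) :+ w) refl _ _ _ _ ⟩
    f 0 * (g 0 + Σ< n (g ∘ suc)) + Σ< n (f ∘ suc ⋆ g) ∎

  -- The coefficients of the formal derivative.
  ∂ : (ℕ → Carrier) → ℕ → Carrier
  ∂ f k = suc k · f (suc k)

  -- The Leibniz rule. In the inductive step one of the 2 + k copies of the tail is set aside; it
  -- makes up the difference between `∂ (f ∘ suc)` and `∂ f ∘ suc`.
  ∂-⋆ : ∀ f g k → ∂ (f ⋆ g) k ≈ (∂ f ⋆ g) k + (f ⋆ ∂ g) k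
  ∂-⋆ f g zero = begin
    (f 0 * g 1 + f 1 * g 0) + 0#
      ≈⟨ solve 4 (λ x y z w → (x :* z :+ y :* w) :+ con (+ 0) :=
                              (y :+ con (+ 0)) :* w :+ x :* (z :+ con (+ 0))) refl _ _ _ _ ⟩
    (f 1 + 0#) * g 0 + f 0 * (g 1 + 0#)  ∎
  ∂-⋆ f g (suc k) = begin
    suc (suc k) · (f 0 * g (2 ℕ.+ k) + (f ∘ suc ⋆ g) (suc k))
      ≈⟨ ×-distrib-+ (f 0 * g (2 ℕ.+ k)) ((f ∘ suc ⋆ g) (suc k)) (suc (suc k)) ⟩
    suc (suc k) · (f 0 * g (2 ℕ.+ k)) + ((f ∘ suc ⋆ g) (suc k) + ∂ (f ∘ suc ⋆ g) k)
      ≈⟨ +-cong (sym (×-comm-* (suc (suc k)) _ _)) (+-congˡ (∂-⋆ (f ∘ suc) g k)) ⟩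
    f 0 * ∂ g (suc k) + ((f 1 * g (suc k) + (f ∘ suc ∘ suc ⋆ g) k)
                         + ((∂ (f ∘ suc) ⋆ g) k + (f ∘ suc ⋆ ∂ g) k))
      ≈⟨ solve 5 (λ a b c d e → a :+ ((b :+ c) :+ (d :+ e)) := (b :+ (c :+ d)) :+ (a :+ e))
               refl _ _ _ _ _ ⟩
    (f 1 * g (suc k) + ((f ∘ suc ∘ suc ⋆ g) k + (∂ (f ∘ suc) ⋆ g) k))
      + (f 0 * ∂ g (suc k) + (f ∘ suc ⋆ ∂ g) k)
      ≈⟨ +-congʳ (+-cong (*-congʳ (+-identityʳ _)) (⋆-distribʳ _ _ g k)) ⟨
    (∂ f ⋆ g) (suc k) + (f ⋆ ∂ g) (suc k)  ∎

  ⋆-exp : ∀ {a b f g} → ∂ f ≋ (λ k → a * f k) → ∂ g ≋ (λ k → b * g k) →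
          ∂ (f ⋆ g) ≋ (λ k → (a + b) * (f ⋆ g) k)
  ⋆-exp {a} {b} {f} {g} ∂f ∂g k = begin
    ∂ (f ⋆ g) k                                        ≈⟨ ∂-⋆ f g k ⟩
    (∂ f ⋆ g) k + (f ⋆ ∂ g) k                          ≈⟨ +-cong (⋆-cong ∂f (λ _ → refl) k) (⋆-cong (λ _ → refl) ∂g k) ⟩
    ((λ i → a * f i) ⋆ g) k + (f ⋆ (λ i → b * g i)) k  ≈⟨ +-cong (⋆-*ˡ a f g k) (⋆-*ʳ b f g k) ⟩
    a * (f ⋆ g) k + b * (f ⋆ g) k                      ≈⟨ distribʳ _ _ _ ⟨
    (a + b) * (f ⋆ g) k                                ∎

  -- The equation f′ = a f expresses (k + 1) f (k + 1) by f k, so the constant term determines the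
  -- rest once positive integers can be cancelled.
  exp-unique : (∀ k {x y} → suc k · x ≈ suc k · y → x ≈ y) →
               ∀ {a f g} → ∂ f ≋ (λ k → a * f k) → ∂ g ≋ (λ k → a * g k) → f 0 ≈ g 0 → f ≋ g
  exp-unique cancel ∂f ∂g f≈g zero    = f≈g
  exp-unique cancel ∂f ∂g f≈g (suc k) =
    cancel k (trans (∂f k) (trans (*-congˡ (exp-unique cancel ∂f ∂g f≈g k)) (sym (∂g k))))

  x-y≈0⇒x≈y : ∀ {x y} → x - y ≈ 0# → x ≈ y
  x-y≈0⇒x≈y {x} {y} x-y≈0 = trans (solve 2 (λ x y → x := x :- y :+ y) refl x y)
    (trans (+-congʳ x-y≈0) (+-identityˡ y))

  Σ<-difference-0 : ∀ n f → Σ< n f - Σ< 0 f ≈ Σ< n f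
  Σ<-difference-0 n f = solve 1 (λ x → x :- con (+ 0) := x) refl (Σ< n f)

  Σ<-difference-suc : ∀ m n f → Σ< (suc m) f - Σ< (suc n) f ≈ Σ< m (f ∘ suc) - Σ< n (f ∘ suc)
  Σ<-difference-suc m n f =
    solve 3 (λ x y z → (x :+ y) :- (x :+ z) := y :- z) refl (f 0) (Σ< m (f ∘ suc)) (Σ< n (f ∘ suc))

  ⋆-difference-0 : ∀ f g w → Σ< 0 f * w - Σ< 0 (f ⋆ g) ≈ 0#
  ⋆-difference-0 f g w = solve 1 (λ w → con (+ 0) :* w :- con (+ 0) := con (+ 0)) refl w

  ⋆-difference-suc : ∀ n f g w → Σ< (suc n) f * w - Σ< (suc n) (f ⋆ g) ≈
                     - (f 0 * (Σ< (suc n) g - w)) + (Σ< n (f ∘ suc) * w - Σ< n (f ∘ suc ⋆ g))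
  ⋆-difference-suc n f g w = trans (+-congˡ (-‿cong (Σ<-⋆ f g n)))
    (solve 5 (λ f₀ F w G T → (f₀ :+ F) :* w :- (f₀ :* G :+ T) :=
                             (:- (f₀ :* (G :- w))) :+ (F :* w :- T))
       refl (f 0) (Σ< n (f ∘ suc)) w (Σ< (suc n) g) (Σ< n (f ∘ suc ⋆ g)))

-- Complex numbers over a commutative ring.

module Complexification (R : CommutativeRing c ℓ) where

  open CommutativeRing R
  open IntegerCoefficients R

  infix 4 _≈ᶜ_
  _≈ᶜ_ : Carrier × Carrier → Carrier × Carrier → Set ℓ
  (a , b) ≈ᶜ (a′ , b′) = a ≈ a′ × b ≈ b′

  _+ᶜ_ _*ᶜ_ : Carrier × Carrier → Carrier × Carrier → Carrier × Carrier
  (a , b) +ᶜ (a′ , b′) = a + a′ , b + b′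
  (a , b) *ᶜ (a′ , b′) = a * a′ - b * b′ , a * b′ + b * a′

  -ᶜ_ : Carrier × Carrier → Carrier × Carrier
  -ᶜ (a , b) = - a , - b

  -- Opaque: comparing two copies of complexRing would otherwise unfold the solver's proofs.
  abstract
    isCommutativeRing-ℂ : IsCommutativeRing _≈ᶜ_ _+ᶜ_ _*ᶜ_ -ᶜ_ (0# , 0#) (1# , 0#)
    isCommutativeRing-ℂ = record
      { isRing = record
        { +-isAbelianGroup = AbelianGroup.isAbelianGroup (DirectProduct.abelianGroup +-abelianGroup +-abelianGroup)
        ; *-cong = λ (p , q) (p′ , q′) → +-cong (*-cong p p′) (-‿cong (*-cong q q′))
                                        , +-cong (*-cong p q′) (*-cong q p′)
        ; *-assoc = λ (a , b) (a′ , b′) (a″ , b″) →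
            solve 6 (λ a b a′ b′ a″ b″ →
              (a :* a′ :- b :* b′) :* a″ :- (a :* b′ :+ b :* a′) :* b″ :=
              a :* (a′ :* a″ :- b′ :* b″) :- b :* (a′ :* b″ :+ b′ :* a″)) refl a b a′ b′ a″ b″ ,
            solve 6 (λ a b a′ b′ a″ b″ →
              (a :* a′ :- b :* b′) :* b″ :+ (a :* b′ :+ b :* a′) :* a″ :=
              a :* (a′ :* b″ :+ b′ :* a″) :+ b :* (a′ :* a″ :- b′ :* b″)) refl a b a′ b′ a″ b″
        ; *-identity = (λ (a , b) →
              solve 2 (λ a b → con (+ 1) :* a :- con (+ 0) :* b := a) refl a b ,
              solve 2 (λ a b → con (+ 1) :* b :+ con (+ 0) :* a := b) refl a b)
            , (λ (a , b) →
              solve 2 (λ a b → a :* con (+ 1) :- b :* con (+ 0) := a) refl a b ,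
              solve 2 (λ a b → a :* con (+ 0) :+ b :* con (+ 1) := b) refl a b)
        ; distrib = (λ (a , b) (a′ , b′) (a″ , b″) →
              solve 6 (λ a b a′ b′ a″ b″ →
                a :* (a′ :+ a″) :- b :* (b′ :+ b″) :=
                (a :* a′ :- b :* b′) :+ (a :* a″ :- b :* b″)) refl a b a′ b′ a″ b″ ,
              solve 6 (λ a b a′ b′ a″ b″ →
                a :* (b′ :+ b″) :+ b :* (a′ :+ a″) :=
                (a :* b′ :+ b :* a′) :+ (a :* b″ :+ b :* a″)) refl a b a′ b′ a″ b″)
            , (λ (a , b) (a′ , b′) (a″ , b″) →
              solve 6 (λ a b a′ b′ a″ b″ →
                (a′ :+ a″) :* a :- (b′ :+ b″) :* b :=
                (a′ :* a :- b′ :* b) :+ (a″ :* a :- b″ :* b)) refl a b a′ b′ a″ b″ ,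
              solve 6 (λ a b a′ b′ a″ b″ →
                (a′ :+ a″) :* b :+ (b′ :+ b″) :* a :=
                (a′ :* b :+ b′ :* a) :+ (a″ :* b :+ b″ :* a)) refl a b a′ b′ a″ b″)
        }
      ; *-comm = λ (a , b) (a′ , b′) →
          solve 4 (λ a b a′ b′ → a :* a′ :- b :* b′ := a′ :* a :- b′ :* b) refl a b a′ b′ ,
          solve 4 (λ a b a′ b′ → a :* b′ :+ b :* a′ := a′ :* b :+ b′ :* a) refl a b a′ b′
      }

  complexRing : CommutativeRing c ℓ
  complexRing = record { isCommutativeRing = isCommutativeRing-ℂ }

-- Constructive order, absolute bounds and powers of one half.

module RealOrder (ℝ : RealNumbers c ℓ₁ ℓ₂ ℓ₃) where

  open RealNumbers ℝ
  open RealProperties ℝ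
  open IntegerCoefficients commutativeRing
  open RingProperties ring using (-0#≈0#; -‿involutive)
  open SemiringExp semiring using (^-congˡ)
  open SemiringMult semiring using (×1-homo-*)
  open CommutativeSemiringExp (CommutativeRing.commutativeSemiring commutativeRing) using (^-distrib-*)
  open SetoidReasoning (CommutativeRing.setoid commutativeRing)

  fromℕ-fromℤ : ∀ n → fromℕ n ≈ fromℤ (+ n)
  fromℕ-fromℤ n = SemiringMultTC.×ᵤ≈× semiring n 1#

  fromℕ-*-homo : ∀ m n → fromℕ (m ℕ.* n) ≈ fromℕ m * fromℕ n
  fromℕ-*-homo = ×1-homo-*

  fromℕ-+-homo : ∀ m n → fromℕ (m ℕ.+ n) ≈ fromℕ m + fromℕ n
  fromℕ-+-homo = SemiringMult.×-homo-+ semiring 1#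

  fromℕ-^-homo : ∀ m n → fromℕ (m ℕ.^ n) ≈ fromℕ m ^ n
  fromℕ-^-homo m zero    = +-identityʳ 1#
  fromℕ-^-homo m (suc n) = trans (fromℕ-*-homo m (m ℕ.^ n)) (*-congˡ (fromℕ-^-homo m n))

  *-cancelˡ-invertible : ∀ {x u y z} → u * x ≈ 1# → x * y ≈ x * z → y ≈ z
  *-cancelˡ-invertible {x} {u} {y} {z} ux≈1 xy≈xz = begin
    y            ≈⟨ *-identityˡ y ⟨
    1# * y       ≈⟨ *-congʳ ux≈1 ⟨
    u * x * y    ≈⟨ *-assoc u x y ⟩
    u * (x * y)  ≈⟨ *-congˡ xy≈xz ⟩
    u * (x * z)  ≈⟨ *-assoc u x z ⟨
    u * x * z    ≈⟨ *-congʳ ux≈1 ⟩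
    1# * z       ≈⟨ *-identityˡ z ⟩
    z            ∎

  ⁻¹-* : ∀ x (0<x : 0# < x) → x ⁻¹[ 0<x ] * x ≈ 1#
  ⁻¹-* x 0<x = trans (*-comm _ _) (*-⁻¹ x 0<x)

  infix 4 _≤_
  -- As a negation it can be proved by refuting a strict inequality, which is how bounds on limits
  -- arise; "less or equal" as a disjunction would require a decision.
  _≤_ : Carrier → Carrier → Set ℓ₃
  x ≤ y = ¬ (y < x)

  -- Inherited from cotransitivity of apartness, this takes the place of trichotomy.
  <-cotrans : ∀ {x y} → x < y → ∀ z → x < z ⊎ z < y
  <-cotrans x<y z with #-cotrans (<⇒# x<y) z
  ... | inj₁ x#z with #⇒< x#z
  ...   | inj₁ x<z = inj₁ x<z
  ...   | inj₂ z<x = inj₂ (<-trans z<x x<y)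
  <-cotrans x<y z | inj₂ z#y with #⇒< z#y
  ...   | inj₁ z<y = inj₂ z<y
  ...   | inj₂ y<z = inj₁ (<-trans x<y y<z)

  ≤-trans : ∀ {x y z} → x ≤ y → y ≤ z → x ≤ z
  ≤-trans {y = y} x≤y y≤z z<x with <-cotrans z<x y
  ... | inj₁ z<y = y≤z z<y
  ... | inj₂ y<x = x≤y y<x

  ≤-reflexive : ∀ {x y} → x ≈ y → x ≤ y
  ≤-reflexive x≈y = <-irrefl (sym x≈y)

  <⇒≤ : ∀ {x y} → x < y → x ≤ y
  <⇒≤ x<y y<x = <-irrefl refl (<-trans x<y y<x)

  <-≤-trans : ∀ {x y z} → x < y → y ≤ z → x < z
  <-≤-trans {z = z} x<y y≤z with <-cotrans x<y z
  ... | inj₁ x<z = x<z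
  ... | inj₂ z<y = ⊥-elim (y≤z z<y)

  ≤-resp-≈ : ∀ {x x′ y y′} → x ≈ x′ → y ≈ y′ → x ≤ y → x′ ≤ y′
  ≤-resp-≈ x≈x′ y≈y′ x≤y y′<x′ = x≤y (<-respˡ-≈ (sym y≈y′) (<-respʳ-≈ (sym x≈x′) y′<x′))

  ≤-antisym : ∀ {x y} → x ≤ y → y ≤ x → x ≈ y
  ≤-antisym {x} {y} x≤y y≤x = proj₁ (tight x y) λ x#y → case x#y
    where
    case : ¬ (x # y)
    case x#y with #⇒< x#y
    ... | inj₁ x<y = y≤x x<y
    ... | inj₂ y<x = x≤y y<x

  +-monoˡ-≤ : ∀ z {x y} → x ≤ y → x + z ≤ y + z
  +-monoˡ-≤ z x≤y y+z<x+z =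
    x≤y (<-respˡ-≈ (cancel _) (<-respʳ-≈ (cancel _) (+-monoˡ-< (- z) y+z<x+z)))
    where
    cancel : ∀ x → x + z - z ≈ x
    cancel x = solve 2 (λ x z → x :+ z :- z := x) refl x z

  +-mono-≤ : ∀ {x y x′ y′} → x ≤ y → x′ ≤ y′ → x + x′ ≤ y + y′
  +-mono-≤ {y = y} {x′} x≤y x′≤y′ =
    ≤-trans (+-monoˡ-≤ x′ x≤y) (≤-resp-≈ (+-comm _ _) (+-comm _ _) (+-monoˡ-≤ y x′≤y′))

  x≤y⇒0≤y-x : ∀ {x y} → x ≤ y → 0# ≤ y - x
  x≤y⇒0≤y-x {x} x≤y = ≤-resp-≈ (-‿inverseʳ x) refl (+-monoˡ-≤ (- x) x≤y)

  0≤y-x⇒x≤y : ∀ {x y} → 0# ≤ y - x → x ≤ y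
  0≤y-x⇒x≤y {x} {y} 0≤y-x =
    ≤-resp-≈ (+-identityˡ x) (solve 2 (λ x y → y :- x :+ x := y) refl x y) (+-monoˡ-≤ x 0≤y-x)

  *-#0ˡ : ∀ {x y} → x * y # 0# → x # 0#
  *-#0ˡ {x} {y} xy#0 with #⇒invertible xy#0
  ... | u , u*xy≈1 , _ = invertible⇒# (y * u ,
        trans (solve 3 (λ x y u → y :* u :* (x :- con (+ 0)) := u :* (x :* y :- con (+ 0))) refl x y u) u*xy≈1 ,
        trans (solve 3 (λ x y u → (x :- con (+ 0)) :* (y :* u) := u :* (x :* y :- con (+ 0))) refl x y u) u*xy≈1)

  ≤∧#⇒< : ∀ {x} → 0# ≤ x → x # 0# → 0# < x
  ≤∧#⇒< 0≤x x#0 with #⇒< x#0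
  ... | inj₁ x<0 = ⊥-elim (0≤x x<0)
  ... | inj₂ 0<x = 0<x

  -- The assumption x y < 0 to be refuted makes x y invertible, hence both factors apart from 0.
  -- Being nonnegative, they are then positive, and so is x y.
  *-nonneg : ∀ {x y} → 0# ≤ x → 0# ≤ y → 0# ≤ x * y
  *-nonneg {x} {y} 0≤x 0≤y xy<0 = <-irrefl refl (<-trans xy<0 (*-pos
    (≤∧#⇒< 0≤x (*-#0ˡ (<⇒# xy<0)))
    (≤∧#⇒< 0≤y (*-#0ˡ (<⇒# (<-respˡ-≈ (*-comm x y) xy<0))))))

  *-monoˡ-≤ : ∀ {x y z} → 0# ≤ z → x ≤ y → z * x ≤ z * y
  *-monoˡ-≤ {x} {y} {z} 0≤z x≤y = 0≤y-x⇒x≤y (≤-resp-≈ refl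
    (solve 3 (λ x y z → z :* (y :- x) := z :* y :- z :* x) refl x y z)
    (*-nonneg 0≤z (x≤y⇒0≤y-x x≤y)))

  0≤2x⇒0≤x : ∀ {x} → 0# ≤ x + x → 0# ≤ x
  0≤2x⇒0≤x 0≤2x x<0 = 0≤2x (<-trans (<-respʳ-≈ (+-identityˡ _) (+-monoˡ-< _ x<0)) x<0)

  ^-pos : ∀ {x} → 0# < x → ∀ n → 0# < x ^ n
  ^-pos 0<x zero    = 0<1
  ^-pos 0<x (suc n) = *-pos 0<x (^-pos 0<x n)

  fromℕ-nonneg : ∀ n → 0# ≤ fromℕ n
  fromℕ-nonneg zero    = ≤-reflexive refl
  fromℕ-nonneg (suc n) = <⇒≤ (fromℕ-pos (suc n))

  fromℕ-mono-≤ : ∀ {m n} → m ℕ.≤ n → fromℕ m ≤ fromℕ n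
  fromℕ-mono-≤ {m} {n} m≤n = ≤-resp-≈ (+-identityˡ _)
    (trans (sym (fromℕ-+-homo (n ℕ.∸ m) m)) (reflexive (≡.cong fromℕ (ℕ.m∸n+n≡m m≤n))))
    (+-monoˡ-≤ (fromℕ m) (fromℕ-nonneg (n ℕ.∸ m)))

  -- ∣ x ∣≤ r stands for |x| ≤ r; an absolute value function is not available.
  record ∣_∣≤_ (x r : Carrier) : Set ℓ₃ where
    constructor _,_
    field
      lower : - r ≤ x
      upper : x ≤ r

  open ∣_∣≤_

  ∣∣-resp-≈ : ∀ {x y r s} → x ≈ y → r ≈ s → ∣ x ∣≤ r → ∣ y ∣≤ s
  ∣∣-resp-≈ x≈y r≈s (l , u) = ≤-resp-≈ (-‿cong r≈s) x≈y l , ≤-resp-≈ x≈y r≈s u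

  ∣∣-neg : ∀ {x r} → ∣ x ∣≤ r → ∣ - x ∣≤ r
  ∣∣-neg (l , u) = neg u , ≤-resp-≈ refl (-‿involutive _) (neg l)
    where
    neg : ∀ {x y} → x ≤ y → - y ≤ - x
    neg {x} {y} x≤y = 0≤y-x⇒x≤y (≤-resp-≈ refl
      (solve 2 (λ x y → y :- x := :- x :- (:- y)) refl x y) (x≤y⇒0≤y-x x≤y))

  ∣∣-weaken : ∀ {x r s} → r ≤ s → ∣ x ∣≤ r → ∣ x ∣≤ s
  ∣∣-weaken {x} {r} {s} r≤s (l , u) =
    0≤y-x⇒x≤y (≤-resp-≈ (+-identityˡ 0#)
      (solve 3 (λ x r s → (x :- (:- r)) :+ (s :- r) := x :- (:- s)) refl x r s)
      (+-mono-≤ (x≤y⇒0≤y-x l) (x≤y⇒0≤y-x r≤s))) ,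
    ≤-trans u r≤s

  ∣∣-+ : ∀ {x y r s} → ∣ x ∣≤ r → ∣ y ∣≤ s → ∣ x + y ∣≤ (r + s)
  ∣∣-+ {r = r} {s} (l , u) (l′ , u′) =
    ≤-resp-≈ (solve 2 (λ r s → (:- r) :- s := :- (r :+ s)) refl r s) refl (+-mono-≤ l l′) , +-mono-≤ u u′

  ∣∣-- : ∀ {x y r s} → ∣ x ∣≤ r → ∣ y ∣≤ s → ∣ x - y ∣≤ (r + s)
  ∣∣-- p q = ∣∣-+ p (∣∣-neg q)

  ∣∣-* : ∀ {x y r s} → ∣ x ∣≤ r → ∣ y ∣≤ s → ∣ x * y ∣≤ (r * s)
  ∣∣-* {x} {y} {r} {s} p q =
    0≤y-x⇒x≤y (≤-resp-≈ refl
      (solve 3 (λ x y t → t :- (:- x) :* y := x :* y :- (:- t)) refl x y (r * s))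
      (x≤y⇒0≤y-x (upper* (∣∣-neg p)))) ,
    upper* p
    where
    -- 2 (r s - x y) = (r - x) (s + y) + (r + x) (s - y)
    upper* : ∀ {x} → ∣ x ∣≤ r → x * y ≤ r * s
    upper* {x} (l , u) = 0≤y-x⇒x≤y (0≤2x⇒0≤x (≤-resp-≈ (+-identityˡ 0#)
      (solve 4 (λ x y r s → (r :- x) :* (y :- (:- s)) :+ (x :- (:- r)) :* (s :- y) :=
                            (r :* s :- x :* y) :+ (r :* s :- x :* y)) refl x y r s)
      (+-mono-≤ (*-nonneg (x≤y⇒0≤y-x u) (x≤y⇒0≤y-x (lower q)))
                (*-nonneg (x≤y⇒0≤y-x l) (x≤y⇒0≤y-x (upper q))))))

  ∣∣-0 : ∀ {x r} → x ≈ 0# → 0# ≤ r → ∣ x ∣≤ r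
  ∣∣-0 {x} {r} x≈0 0≤r =
    0≤y-x⇒x≤y (≤-resp-≈ refl (trans (sym (+-identityˡ _)) (+-cong (sym x≈0) (sym (-‿involutive r)))) 0≤r) ,
    ≤-resp-≈ (sym x≈0) refl 0≤r

  ∣∣-nonneg : ∀ {x r} → 0# ≤ x → x ≤ r → ∣ x ∣≤ r
  ∣∣-nonneg {x} {r} 0≤x x≤r =
    0≤y-x⇒x≤y (≤-resp-≈ (+-identityˡ 0#) (solve 2 (λ x r → x :+ r := x :- (:- r)) refl x r)
      (+-mono-≤ 0≤x (≤-trans 0≤x x≤r))) , x≤r

  ∣∣⇒0≤ : ∀ {x r} → ∣ x ∣≤ r → 0# ≤ r
  ∣∣⇒0≤ {x} {r} (l , u) = 0≤2x⇒0≤x (≤-resp-≈ refl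
    (solve 1 (λ r → r :- (:- r) := r :+ r) refl r) (x≤y⇒0≤y-x (≤-trans l u)))

  ∃-bound : ∀ x → ∃ λ B → ∣ x ∣≤ fromℕ B
  ∃-bound x with archimedean x | archimedean (- x)
  ... | m , x<m | n , -x<n = m ℕ.+ n ,
    ( 0≤y-x⇒x≤y (≤-resp-≈ refl 
        (solve 2 (λ x r → r :- (:- x) := x :- (:- r)) refl x (fromℕ (m ℕ.+ n)))
        (x≤y⇒0≤y-x (≤-trans (<⇒≤ -x<n) (fromℕ-mono-≤ (ℕ.m≤n+m n m)))))
    , ≤-trans (<⇒≤ x<m) (fromℕ-mono-≤ (ℕ.m≤m+n m n)))

  abstract
    ½ : Carrier
    ½ = recip 2

    ½-pos : 0# < ½
    ½-pos = ⁻¹-pos _ (fromℕ-pos 2)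

    2*½≈1 : fromℕ 2 * ½ ≈ 1#
    2*½≈1 = *-⁻¹ _ (fromℕ-pos 2)

  ½^-nonneg : ∀ n → 0# ≤ ½ ^ n
  ½^-nonneg n = <⇒≤ (^-pos ½-pos n)

  ½+½≈1 : ½ + ½ ≈ 1#
  ½+½≈1 = trans (solve 1 (λ h → h :+ h := con (+ 2) :* h) refl ½)
            (trans (*-congʳ (sym (fromℕ-fromℤ 2))) 2*½≈1)

  2^n*½^n≈1 : ∀ n → fromℕ (2 ℕ.^ n) * ½ ^ n ≈ 1#
  2^n*½^n≈1 n = begin
    fromℕ (2 ℕ.^ n) * ½ ^ n  ≈⟨ *-congʳ (fromℕ-^-homo 2 n) ⟩
    fromℕ 2 ^ n * ½ ^ n      ≈⟨ ^-distrib-* (fromℕ 2) ½ n ⟨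
    (fromℕ 2 * ½) ^ n        ≈⟨ ^-congˡ n 2*½≈1 ⟩
    1# ^ n                   ≈⟨ 1^n≈1 n ⟩
    1#                       ∎
    where
    1^n≈1 : ∀ n → 1# ^ n ≈ 1#
    1^n≈1 zero    = refl
    1^n≈1 (suc n) = trans (*-identityˡ _) (1^n≈1 n)

  n≤2^n : ∀ n → n ℕ.≤ 2 ℕ.^ n
  n≤2^n zero    = ℕ.z≤n
  n≤2^n (suc n) = ℕ.+-mono-≤ (ℕ.m^n>0 2 n) (ℕ.≤-trans (n≤2^n n) (ℕ.m≤m+n _ 0))

  -- If K < n x then K ½ⁿ < n x ½ⁿ ≤ x.
  ½^-archimedean : ∀ K {x} → 0# < x → ∃ λ n → K * ½ ^ n < x
  ½^-archimedean K {x} 0<x with archimedean (x ⁻¹[ 0<x ] * K)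
  ... | n , K/x<n = n , <-respˡ-≈ (*-comm _ _) (<-≤-trans (*-monoˡ-< (^-pos ½-pos n) K<nx)
        (≤-resp-≈ refl eq₂ (*-monoˡ-≤ (½^-nonneg n) (*-monoˡ-≤ (<⇒≤ 0<x) (fromℕ-mono-≤ (n≤2^n n))))))
    where
    K<nx : K < x * fromℕ n
    K<nx = <-respˡ-≈ (trans (sym (*-assoc _ _ _)) (trans (*-congʳ (*-⁻¹ x 0<x)) (*-identityˡ K)))
             (*-monoˡ-< 0<x K/x<n)
    eq₂ : ½ ^ n * (x * fromℕ (2 ℕ.^ n)) ≈ x
    eq₂ = begin
      ½ ^ n * (x * fromℕ (2 ℕ.^ n))
        ≈⟨ solve 3 (λ a b c → a :* (b :* c) := b :* (c :* a)) refl (½ ^ n) x (fromℕ (2 ℕ.^ n)) ⟩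
      x * (fromℕ (2 ℕ.^ n) * ½ ^ n)  ≈⟨ *-congˡ (2^n*½^n≈1 n) ⟩
      x * 1#                         ≈⟨ *-identityʳ x ⟩
      x                              ∎

  -- The passage from estimates to equations: uniqueness of limits and the addition law of exp both
  -- rest on it.
  squeeze : ∀ {K x} → (∀ n → ∣ x ∣≤ (K * ½ ^ n)) → x ≈ 0#
  squeeze {K} {x} bound = ≤-antisym x≤0 0≤x
    where
    x≤0 : x ≤ 0#
    x≤0 0<x = let (n , K½ⁿ<x) = ½^-archimedean K 0<x in upper (bound n) K½ⁿ<x
    0≤x : 0# ≤ x
    0≤x x<0 = let (n , K½ⁿ<-x) = ½^-archimedean K (neg-pos x<0) in upper (∣∣-neg (bound n)) K½ⁿ<-x

-- Doubled indices and the growth of factorials.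

double : ℕ → ℕ
double zero    = zero
double (suc n) = suc (suc (double n))

-- The sine takes every second term of the exponential series. `double` exposes two successors at a
-- time to recursion; `2 ℕ.* n`, as in the sine series, does not.
2*n≡double : ∀ n → 2 ℕ.* n ≡ double n
2*n≡double zero    = ≡.refl
2*n≡double (suc n) = ≡.trans (ℕ.*-suc 2 n) (≡.cong (suc ∘ suc) (2*n≡double n))

n≤double : ∀ n → n ℕ.≤ double n
n≤double zero    = ℕ.z≤n
n≤double (suc n) = ℕ.s≤s (ℕ.m≤n⇒m≤1+n (n≤double n))

-- Up to exponent m the factor mᵐ alone suffices. Each later step multiplies the left side by m and
-- the right side by a number exceeding m.
power≤factorial : ∀ m .{{_ : NonZero m}} n → m ℕ.^ n ℕ.≤ m ℕ.^ m ℕ.* n !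
power≤factorial m zero    = ≡.subst (1 ℕ.≤_) (≡.sym (ℕ.*-identityʳ _)) (ℕ.m^n>0 m m)
power≤factorial m (suc n) with suc n ℕ.≤? m
... | yes n<m = ℕ.≤-trans (ℕ.^-monoʳ-≤ m n<m) (ℕ.m≤m*n _ (suc n !) {{suc n ℕ.!≢0}})
... | no  n≮m = ≡.subst (m ℕ.* m ℕ.^ n ℕ.≤_)
  (≡.trans (≡.sym (ℕ.*-assoc (suc n) (m ℕ.^ m) (n !)))
    (≡.trans (≡.cong (ℕ._* n !) (ℕ.*-comm (suc n) (m ℕ.^ m))) (ℕ.*-assoc (m ℕ.^ m) (suc n) (n !))))
  (ℕ.*-mono-≤ (ℕ.<⇒≤ (ℕ.≰⇒> n≮m)) (power≤factorial m n))

-- Sequences that converge geometrically.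

module FastConvergence (ℝ : RealNumbers c ℓ₁ ℓ₂ ℓ₃) where

  open RealNumbers ℝ
  open RealProperties ℝ
  open RealOrder ℝ
  open ∣_∣≤_
  open IntegerCoefficients commutativeRing

  Fast : (ℕ → Carrier) → Carrier → Set ℓ₃
  Fast f R = ∀ n d → ∣ f (n ℕ.+ d) - f n ∣≤ (R * ½ ^ n)

  fast-≤ : ∀ {f R n m} → Fast f R → n ℕ.≤ m → ∣ f m - f n ∣≤ (R * ½ ^ n)
  fast-≤ {f} {R} {n} {m} fast n≤m =
    ≡.subst (λ k → ∣ f k - f n ∣≤ (R * ½ ^ n)) (ℕ.m+[n∸m]≡n n≤m) (fast n (m ℕ.∸ n))

  x<y+ε : ∀ {x y ε} → x - y < ε → x < y + ε
  x<y+ε {x} {y} x-y<ε =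
    <-respˡ-≈ (solve 2 (λ x y → x :- y :+ y := x) refl x y) (<-respʳ-≈ (+-comm _ _) (+-monoˡ-< y x-y<ε))

  ≤-<-trans : ∀ {x y z} → x ≤ y → y < z → x < z
  ≤-<-trans {x} x≤y y<z = case <-cotrans y<z x of λ where
    (inj₁ y<x) → ⊥-elim (x≤y y<x)
    (inj₂ x<z) → x<z

  fast⇒cauchy : ∀ {f R} → Fast f R → (φ : ℕ → ℕ) → (∀ i → i ℕ.≤ φ i) → IsCauchy (f ∘ φ)
  fast⇒cauchy {f} {R} fast φ i≤φi ε 0<ε =
    let (n , small) = ½^-archimedean (R + R) 0<ε in
    n , λ i j n≤i n≤j → x<y+ε (≤-<-trans
      (upper (∣∣-resp-≈
        (solve 3 (λ x y z → (x :- z) :- (y :- z) := x :- y) refl (f (φ i)) (f (φ j)) (f n))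
        (sym (distribʳ (½ ^ n) R R))
        (∣∣-- (fast-≤ {f} fast (ℕ.≤-trans n≤i (i≤φi i))) (fast-≤ {f} fast (ℕ.≤-trans n≤j (i≤φi j))))))
      small)

  -- A limit known only along a subsequence, and without a rate, still obeys the rate of the whole
  -- sequence. If f n - l exceeded the bound, let ε be the excess: a term f (φ i) within ε of l
  -- would then be too far from f n.
  fast-limit : ∀ {f R} → Fast f R → (φ : ℕ → ℕ) → (∀ i → i ℕ.≤ φ i) →
               ∀ {g l} → (∀ i → g i ≈ f (φ i)) → g ConvergesTo l →
               ∀ n → ∣ f n - l ∣≤ (R * ½ ^ n)
  fast-limit {f} {R} fast φ i≤φi {g} {l} g≈f∘φ g→l n = lo , up
    where
    r = R * ½ ^ n
    far : ∀ N → ∣ f (φ (N ℕ.⊔ n)) - f n ∣≤ r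
    far N = fast-≤ {f} fast (ℕ.≤-trans (ℕ.m≤n⊔m N n) (i≤φi (N ℕ.⊔ n)))
    up : f n - l ≤ r
    up r<fn-l =
      let ε = f n - l - r
          (N , near) = g→l ε (<-respˡ-≈ (-‿inverseʳ r) (+-monoˡ-< (- r) r<fn-l))
          i = N ℕ.⊔ n
      in lower (far N) (<-respˡ-≈ (+-congʳ (g≈f∘φ i)) (<-respʳ-≈
           (solve 3 (λ x l r → l :+ (x :- l :- r) :- x := :- r) refl (f n) l r)
           (+-monoˡ-< (- f n) (proj₂ (near i (ℕ.m≤m⊔n N n))))))
    lo : - r ≤ f n - l
    lo fn-l<-r =
      let ε = - r - (f n - l)
          (N , near) = g→l ε (<-respˡ-≈ (-‿inverseʳ _) (+-monoˡ-< (- (f n - l)) fn-l<-r))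
          i = N ℕ.⊔ n
      in upper (far N) (<-respʳ-≈ (+-congʳ (g≈f∘φ i)) (<-respˡ-≈
           (solve 3 (λ x l r → l :- ((:- r) :- (x :- l)) :- x := r) refl (f n) l r)
           (+-monoˡ-< (- f n) (proj₁ (near i (ℕ.m≤m⊔n N n))))))

-- Reciprocal factorials.

module Factorials (ℝ : RealNumbers c ℓ₁ ℓ₂ ℓ₃) where

  open RealNumbers ℝ
  open RealProperties ℝ
  open RealOrder ℝ
  open SemiringExp semiring using (^-congˡ)
  open CommutativeSemiringExp (CommutativeRing.commutativeSemiring commutativeRing) using (^-distrib-*)
  open IntegerCoefficients commutativeRing
  open SetoidReasoning (CommutativeRing.setoid commutativeRing)

  abstract
    1/_! : ℕ → Carrier
    1/ n ! = recip (n !) {{n ℕ.!≢0}}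

    1/!-recip : ∀ n .{{_ : NonZero (n !)}} → 1/ n ! ≈ recip (n !)
    1/!-recip n = refl

    1/!-nonneg : ∀ n → 0# ≤ 1/ n !
    1/!-nonneg n = <⇒≤ (⁻¹-pos _ (fromℕ-pos (n !) {{n ℕ.!≢0}}))

    1/!-inverse : ∀ n → 1/ n ! * fromℕ (n !) ≈ 1#
    1/!-inverse n = ⁻¹-* _ (fromℕ-pos (n !) {{n ℕ.!≢0}})

  1/0!≈1 : 1/ 0 ! ≈ 1#
  1/0!≈1 = trans (sym (*-identityʳ _)) (trans (*-congˡ (sym (+-identityʳ 1#))) (1/!-inverse 0))

  1/!-suc : ∀ n → fromℕ (suc n) * 1/ suc n ! ≈ 1/ n !
  1/!-suc n = *-cancelˡ-invertible (1/!-inverse n) (begin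
    fromℕ (n !) * (fromℕ (suc n) * 1/ suc n !)
      ≈⟨ solve 3 (λ x y z → x :* (y :* z) := z :* (y :* x)) refl (fromℕ (n !)) (fromℕ (suc n)) (1/ suc n !) ⟩
    1/ suc n ! * (fromℕ (suc n) * fromℕ (n !))  ≈⟨ *-congˡ (fromℕ-*-homo (suc n) (n !)) ⟨
    1/ suc n ! * fromℕ (suc n !)                ≈⟨ 1/!-inverse (suc n) ⟩
    1#                                          ≈⟨ 1/!-inverse n ⟨
    1/ n ! * fromℕ (n !)                        ≈⟨ *-comm _ _ ⟩
    fromℕ (n !) * 1/ n !                        ∎)

  -- Since (4 b)ⁿ = 2ⁿ 2ⁿ bⁿ, the choice m = 4 b in `power≤factorial` leaves two factors ½ⁿ. The
  -- second one is spent on Cauchy products, where decay ½ⁿ in both series would give an error of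
  -- order n ½ⁿ.
  power/factorial≤ : ∀ b .{{_ : NonZero b}} → let m = 4 ℕ.* b in
    ∀ n → 1/ n ! * fromℕ (b ℕ.^ n) ≤ fromℕ (m ℕ.^ m) * (½ ^ n * ½ ^ n)
  power/factorial≤ b n = ≤-resp-≈ eq₁ eq₂ (*-monoˡ-≤ 0≤u (fromℕ-mono-≤ (power≤factorial m {{ℕ.m*n≢0 4 b}} n)))
    where
    m = 4 ℕ.* b
    u = 1/ n ! * (½ ^ n * ½ ^ n)
    0≤u : 0# ≤ u
    0≤u = *-nonneg (1/!-nonneg n) (*-nonneg (½^-nonneg n) (½^-nonneg n))
    m^n : fromℕ (m ℕ.^ n) ≈ fromℕ (2 ℕ.^ n) * fromℕ (2 ℕ.^ n) * fromℕ (b ℕ.^ n)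
    m^n = begin
      fromℕ (m ℕ.^ n)                              ≈⟨ fromℕ-^-homo m n ⟩
      fromℕ m ^ n                                  ≈⟨ ^-congˡ n (trans (fromℕ-*-homo 4 b) (*-congʳ (fromℕ-*-homo 2 2))) ⟩
      (fromℕ 2 * fromℕ 2 * fromℕ b) ^ n            ≈⟨ ^-distrib-* (fromℕ 2 * fromℕ 2) (fromℕ b) n ⟩
      (fromℕ 2 * fromℕ 2) ^ n * fromℕ b ^ n        ≈⟨ *-congʳ (^-distrib-* (fromℕ 2) (fromℕ 2) n) ⟩
      fromℕ 2 ^ n * fromℕ 2 ^ n * fromℕ b ^ n
        ≈⟨ *-cong (*-cong (fromℕ-^-homo 2 n) (fromℕ-^-homo 2 n)) (fromℕ-^-homo b n) ⟨
      fromℕ (2 ℕ.^ n) * fromℕ (2 ℕ.^ n) * fromℕ (b ℕ.^ n)  ∎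
    eq₁ : u * fromℕ (m ℕ.^ n) ≈ 1/ n ! * fromℕ (b ℕ.^ n)
    eq₁ = begin
      u * fromℕ (m ℕ.^ n)                ≈⟨ *-congˡ m^n ⟩
      u * (t * t * fromℕ (b ℕ.^ n))
        ≈⟨ solve 4 (λ i h t s → i :* (h :* h) :* (t :* t :* s) := i :* s :* ((t :* h) :* (t :* h)))
             refl (1/ n !) (½ ^ n) t (fromℕ (b ℕ.^ n)) ⟩
      1/ n ! * fromℕ (b ℕ.^ n) * ((t * ½ ^ n) * (t * ½ ^ n))
        ≈⟨ *-congˡ (trans (*-cong (2^n*½^n≈1 n) (2^n*½^n≈1 n)) (*-identityʳ 1#)) ⟩
      1/ n ! * fromℕ (b ℕ.^ n) * 1#      ≈⟨ *-identityʳ _ ⟩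
      1/ n ! * fromℕ (b ℕ.^ n)           ∎
      where t = fromℕ (2 ℕ.^ n)
    eq₂ : u * fromℕ (m ℕ.^ m ℕ.* n !) ≈ fromℕ (m ℕ.^ m) * (½ ^ n * ½ ^ n)
    eq₂ = begin
      u * fromℕ (m ℕ.^ m ℕ.* n !)        ≈⟨ *-congˡ (fromℕ-*-homo (m ℕ.^ m) (n !)) ⟩
      u * (fromℕ (m ℕ.^ m) * fromℕ (n !))
        ≈⟨ solve 4 (λ i h K f → i :* h :* (K :* f) := (i :* f) :* (K :* h))
             refl (1/ n !) (½ ^ n * ½ ^ n) (fromℕ (m ℕ.^ m)) (fromℕ (n !)) ⟩
      1/ n ! * fromℕ (n !) * (fromℕ (m ℕ.^ m) * (½ ^ n * ½ ^ n))  ≈⟨ *-congʳ (1/!-inverse n) ⟩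
      1# * (fromℕ (m ℕ.^ m) * (½ ^ n * ½ ^ n))                    ≈⟨ *-identityˡ _ ⟩
      fromℕ (m ℕ.^ m) * (½ ^ n * ½ ^ n)                           ∎

-- Normed algebras, with the norm given by its upper bounds.

record IsNormed (ℝ : RealNumbers c ℓ₁ ℓ₂ ℓ₃) (algebra : CommutativeRing c ℓ₁)
                (‖_‖≤_ : CommutativeRing.Carrier algebra → RealNumbers.Carrier ℝ → Set ℓ₃)
                (ι : RealNumbers.Carrier ℝ → CommutativeRing.Carrier algebra) :
                Set (c ⊔ ℓ₁ ⊔ ℓ₃) where
  private module R = RealNumbers ℝ
  open RealOrder ℝ using (_≤_; ½)
  open CommutativeRing algebra
  field
    ‖‖-resp-≈  : ∀ {z w r s} → z ≈ w → r R.≈ s → ‖ z ‖≤ r → ‖ w ‖≤ s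
    ‖‖-weaken  : ∀ {z r s} → r ≤ s → ‖ z ‖≤ r → ‖ z ‖≤ s
    ‖‖-neg     : ∀ {z r} → ‖ z ‖≤ r → ‖ - z ‖≤ r
    ‖‖-+       : ∀ {z w r s} → ‖ z ‖≤ r → ‖ w ‖≤ s → ‖ z + w ‖≤ (r R.+ s)
    -- With the factor 2, the maximum norm of ℂ qualifies.
    ‖‖-*       : ∀ {z w r s} → ‖ z ‖≤ r → ‖ w ‖≤ s → ‖ z * w ‖≤ (r R.* s R.+ r R.* s)
    ‖‖⇒0≤      : ∀ {z r} → ‖ z ‖≤ r → R.0# ≤ r
    ‖‖-0       : ∀ {r} → R.0# ≤ r → ‖ 0# ‖≤ r
    ‖‖-1       : ‖ 1# ‖≤ R.1#
    ‖‖-squeeze : ∀ {K z} → (∀ n → ‖ z ‖≤ (K R.* ½ R.^ n)) → z ≈ 0#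
    ‖‖-∃-bound : ∀ z → ∃ λ B → ‖ z ‖≤ R.fromℕ (suc B)
    ι-cong     : ∀ {r s} → r R.≈ s → ι r ≈ ι s
    ι-+        : ∀ r s → ι (r R.+ s) ≈ ι r + ι s
    ι-*        : ∀ r s → ι (r R.* s) ≈ ι r * ι s
    ι-0        : ι R.0# ≈ 0#
    ι-1        : ι R.1# ≈ 1#
    ‖‖-ι*      : ∀ {r z s} → R.0# ≤ r → ‖ z ‖≤ s → ‖ ι r * z ‖≤ (r R.* s)

record NormedAlgebra (ℝ : RealNumbers c ℓ₁ ℓ₂ ℓ₃) : Set (lsuc (c ⊔ ℓ₁ ⊔ ℓ₃)) where
  infix 4 ‖_‖≤_
  field
    algebra  : CommutativeRing c ℓ₁
    ‖_‖≤_    : CommutativeRing.Carrier algebra → RealNumbers.Carrier ℝ → Set ℓ₃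
    ι        : RealNumbers.Carrier ℝ → CommutativeRing.Carrier algebra
    isNormed : IsNormed ℝ algebra ‖_‖≤_ ι

  open CommutativeRing algebra public
  open IsNormed isNormed public

-- Arithmetic of the error bounds.

module Rates (ℝ : RealNumbers c ℓ₁ ℓ₂ ℓ₃) where

  open RealNumbers ℝ
  open RealOrder ℝ
  open IntegerCoefficients commutativeRing
  open SetoidReasoning (CommutativeRing.setoid commutativeRing)

  0≤½ : 0# ≤ ½
  0≤½ = <⇒≤ ½-pos

  +-nonneg : ∀ {x y} → 0# ≤ x → 0# ≤ y → 0# ≤ x + y
  +-nonneg 0≤x 0≤y = ≤-resp-≈ (+-identityˡ 0#) refl (+-mono-≤ 0≤x 0≤y)

  ½^≤1 : ∀ k → ½ ^ k ≤ 1#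
  ½^≤1 zero    = ≤-reflexive refl
  ½^≤1 (suc k) = ≤-trans
    (≤-trans (*-monoˡ-≤ 0≤½ (½^≤1 k)) (≤-resp-≈ (trans (+-identityʳ ½) (sym (*-identityʳ ½))) refl
      (+-mono-≤ (≤-reflexive (refl {½})) 0≤½)))
    (≤-reflexive ½+½≈1)

  x½+x½≈x : ∀ x → x * ½ + x * ½ ≈ x
  x½+x½≈x x = trans (sym (distribˡ x ½ ½)) (trans (*-congˡ ½+½≈1) (*-identityʳ x))

  tail-rate-suc : ∀ K p → (K * ½ + K * ½) * p ≈ (K + K) * (½ * p)
  tail-rate-suc K p =
    solve 3 (λ K h p → (K :* h :+ K :* h) :* p := (K :+ K) :* (h :* p)) refl K ½ p

  square-rate-suc : ∀ K p → K * ((½ * p) * (½ * p)) ≈ K * (½ * ½) * (p * p)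
  square-rate-suc K p =
    solve 3 (λ K h p → K :* ((h :* p) :* (h :* p)) := K :* (h :* h) :* (p :* p)) refl K ½ p

  -- This is 4 r K p. For p = ½ⁿ it bounds the sum over i < n of 2 · K ½²ⁱ · r ½ⁿ⁻ⁱ, with the 2
  -- coming from `‖‖-*`.
  ⋆-rate : (r K p : Carrier) → Carrier
  ⋆-rate r K p = ((r * K + r * K) + (r * K + r * K)) * p

  -- Both summands on the left equal r K p: the first is 2 K r · ½ p, the second 4 r (K / 4) p. The
  -- quartering of K reflects the squared decay of the first series.
  ⋆-rate-suc : ∀ r K p →
    (K * (1# * 1#) * (r * (½ * p)) + K * (1# * 1#) * (r * (½ * p))) + ⋆-rate r (K * (½ * ½)) p ≈
    ⋆-rate r K (½ * p)
  ⋆-rate-suc r K p = begin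
    (K * (1# * 1#) * (r * (½ * p)) + K * (1# * 1#) * (r * (½ * p))) + ⋆-rate r (K * (½ * ½)) p
      ≈⟨ solve 4 (λ K r h p → let K′ = K :* (con (+ 1) :* con (+ 1))
                                  K″ = r :* (K :* (h :* h)) in
           (K′ :* (r :* (h :* p)) :+ K′ :* (r :* (h :* p))) :+ ((K″ :+ K″) :+ (K″ :+ K″)) :* p :=
           (r :* K :* p) :* ((h :+ h) :+ (h :+ h) :* (h :+ h))) refl K r ½ p ⟩
    (r * K * p) * ((½ + ½) + (½ + ½) * (½ + ½))
      ≈⟨ *-congˡ (+-congˡ (trans (*-congˡ ½+½≈1) (*-identityʳ (½ + ½)))) ⟩
    (r * K * p) * ((½ + ½) + (½ + ½))
      ≈⟨ solve 4 (λ K r h p → (r :* K :* p) :* ((h :+ h) :+ (h :+ h)) :=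
           ((r :* K :+ r :* K) :+ (r :* K :+ r :* K)) :* (h :* p)) refl K r ½ p ⟩
    ⋆-rate r K (½ * p)  ∎

  product-rate : ∀ a b r K s p → ((a * p) * b + (a * p) * b) + ⋆-rate r K p + s * p ≈
                 (a * b + a * b + ((r * K + r * K) + (r * K + r * K)) + s) * p
  product-rate a b r K s p =
    solve 5 (λ a b q s p → (a :* p :* b :+ a :* p :* b) :+ q :* p :+ s :* p :=
                           (a :* b :+ a :* b :+ q :+ s) :* p)
      refl a b ((r * K + r * K) + (r * K + r * K)) s p

-- The exponential series in a normed algebra.

module Exponential {ℝ : RealNumbers c ℓ₁ ℓ₂ ℓ₃} (A : NormedAlgebra ℝ) where

  private module R where
    open RealNumbers ℝ public
    open RealProperties ℝ public
    open RealOrder ℝ public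
  open R using (½; _≤_)
  open Rates ℝ
  open Factorials ℝ
  open NormedAlgebra A
  open IntegerCoefficients algebra
  open PowerSeries algebra
  open SemiringExp semiring using (_^_; ^-congˡ)
  open SemiringMult semiring using (×-assoc-*) renaming (_×_ to _·_)

  ‖‖-- : ∀ {z w r s} → ‖ z ‖≤ r → ‖ w ‖≤ s → ‖ z - w ‖≤ r R.+ s
  ‖‖-- p q = ‖‖-+ p (‖‖-neg q)

  -- Shifting `f` halves K, so the induction closes with K + 2 · K ½ = 2 K.
  Σ<-bound : ∀ n {f K} → R.0# ≤ K → (∀ k → ‖ f k ‖≤ K R.* ½ R.^ k) → ‖ Σ< n f ‖≤ K R.+ K
  Σ<-bound zero    0≤K bound = ‖‖-0 (+-nonneg 0≤K 0≤K)
  Σ<-bound (suc n) {K = K} 0≤K bound =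
    ‖‖-resp-≈ refl (R.+-cong (R.*-identityʳ K) (x½+x½≈x K))
      (‖‖-+ (bound 0) (Σ<-bound n (R.*-nonneg 0≤K 0≤½)
        λ k → ‖‖-resp-≈ refl (R.sym (R.*-assoc K ½ (½ R.^ k))) (bound (suc k))))

  Σ<-tail : ∀ {f K} → R.0# ≤ K → (∀ k → ‖ f k ‖≤ K R.* ½ R.^ k) →
            ∀ n d → ‖ Σ< (n ℕ.+ d) f - Σ< n f ‖≤ (K R.+ K) R.* ½ R.^ n
  Σ<-tail {f} {K} 0≤K bound zero d =
    ‖‖-resp-≈ (sym (Σ<-difference-0 d f)) (R.sym (R.*-identityʳ (K R.+ K))) (Σ<-bound d 0≤K bound)
  Σ<-tail {f} {K} 0≤K bound (suc n) d =
    ‖‖-resp-≈ (sym (Σ<-difference-suc (n ℕ.+ d) n f))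
      (tail-rate-suc K (½ R.^ n))
      (Σ<-tail (R.*-nonneg 0≤K 0≤½)
        (λ k → ‖‖-resp-≈ refl (R.sym (R.*-assoc K ½ (½ R.^ k))) (bound (suc k))) n d)

  -- By the head recursion of ⋆, the difference is Σ_{i<n} f i (w - Σ_{j<n-i} g j).
  Σ<-⋆-bound : ∀ {g w r} → (∀ n → ‖ Σ< n g - w ‖≤ r R.* ½ R.^ n) →
               ∀ n {f K} → R.0# ≤ K → (∀ k → ‖ f k ‖≤ K R.* (½ R.^ k R.* ½ R.^ k)) →
               ‖ Σ< n f * w - Σ< n (f ⋆ g) ‖≤ ⋆-rate r K (½ R.^ n)
  Σ<-⋆-bound {g} {w} {r} g→w zero {f} {K} 0≤K bound = ‖‖-resp-≈ (sym (⋆-difference-0 f g w)) R.refl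
    (‖‖-0 (R.*-nonneg (+-nonneg (+-nonneg 0≤rK 0≤rK) (+-nonneg 0≤rK 0≤rK)) (R.½^-nonneg 0)))
    where
    0≤rK : R.0# ≤ r R.* K
    0≤rK = R.*-nonneg (R.≤-resp-≈ R.refl (R.*-identityʳ r) (‖‖⇒0≤ (g→w 0))) 0≤K
  Σ<-⋆-bound {g} {w} {r} g→w (suc n) {f} {K} 0≤K bound =
    ‖‖-resp-≈ (sym (⋆-difference-suc n f g w)) (⋆-rate-suc r K (½ R.^ n))
      (‖‖-+ (‖‖-neg (‖‖-* (bound 0) (g→w (suc n))))
        (Σ<-⋆-bound g→w n (R.*-nonneg 0≤K (R.*-nonneg 0≤½ 0≤½))
          λ k → ‖‖-resp-≈ refl
            (square-rate-suc K (½ R.^ k))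
            (bound (suc k))))

  term : Carrier → ℕ → Carrier
  term z k = ι (1/ k !) * z ^ k

  term-cong : ∀ {z w} → z ≈ w → term z ≋ term w
  term-cong z≈w k = *-congˡ (^-congˡ k z≈w)

  term-0 : ∀ z → term z 0 ≈ 1#
  term-0 z = trans (*-identityʳ _) (trans (ι-cong 1/0!≈1) ι-1)

  ·≈ι* : ∀ n z → n · z ≈ ι (R.fromℕ n) * z
  ·≈ι* zero    z = sym (trans (*-congʳ ι-0) (zeroˡ z))
  ·≈ι* (suc n) z = begin
    z + n · z                           ≈⟨ +-cong (*-identityˡ z) (sym (·≈ι* n z)) ⟨
    1# * z + ι (R.fromℕ n) * z          ≈⟨ distribʳ z _ _ ⟨
    (1# + ι (R.fromℕ n)) * z            ≈⟨ *-congʳ (+-congʳ ι-1) ⟨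
    (ι R.1# + ι (R.fromℕ n)) * z        ≈⟨ *-congʳ (ι-+ R.1# (R.fromℕ n)) ⟨
    ι (R.1# R.+ R.fromℕ n) * z          ∎
    where open SetoidReasoning setoid

  ·-cancelˡ : ∀ k {x y} → suc k · x ≈ suc k · y → x ≈ y
  ·-cancelˡ k {x} {y} eq = begin
    x                              ≈⟨ unit x ⟨
    ι u * (ι (R.fromℕ (suc k)) * x)  ≈⟨ *-congˡ (·≈ι* (suc k) x) ⟨
    ι u * (suc k · x)              ≈⟨ *-congˡ eq ⟩
    ι u * (suc k · y)              ≈⟨ *-congˡ (·≈ι* (suc k) y) ⟩
    ι u * (ι (R.fromℕ (suc k)) * y)  ≈⟨ unit y ⟩
    y                              ∎
    where
    open SetoidReasoning setoid
    0<k = R.fromℕ-pos (suc k)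
    u = R.fromℕ (suc k) R.⁻¹[ 0<k ]
    unit : ∀ z → ι u * (ι (R.fromℕ (suc k)) * z) ≈ z
    unit z = trans (sym (*-assoc _ _ z)) (trans (*-congʳ (trans (sym (ι-* u _))
               (trans (ι-cong (R.⁻¹-* _ 0<k)) ι-1))) (*-identityˡ z))

  ∂-term : ∀ z → ∂ (term z) ≋ (λ k → z * term z k)
  ∂-term z k = begin
    suc k · (ι (1/ suc k !) * (z * z ^ k))               ≈⟨ ·≈ι* (suc k) _ ⟩
    ι (R.fromℕ (suc k)) * (ι (1/ suc k !) * (z * z ^ k))
      ≈⟨ solve 4 (λ a b c d → a :* (b :* (c :* d)) := c :* ((a :* b) :* d)) refl _ _ z (z ^ k) ⟩
    z * ((ι (R.fromℕ (suc k)) * ι (1/ suc k !)) * z ^ k)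
      ≈⟨ *-congˡ (*-congʳ (trans (sym (ι-* _ _)) (ι-cong (1/!-suc k)))) ⟩
    z * (ι (1/ k !) * z ^ k)                             ∎
    where open SetoidReasoning setoid

  -- The binomial theorem in disguise: both sequences start with 1 and solve h′ = (z + w) h.
  term-+ : ∀ z w → term z ⋆ term w ≋ term (z + w)
  term-+ z w = exp-unique ·-cancelˡ (⋆-exp {f = term z} {term w} (∂-term z) (∂-term w)) (∂-term (z + w))
    (trans (*-cong (term-0 z) (term-0 w)) (trans (*-identityˡ 1#) (sym (term-0 (z + w)))))

  -- The base is 2 b because every multiplication costs the factor 2 of `‖‖-*`.
  ^-bound : ∀ {z} b → ‖ z ‖≤ R.fromℕ b → ∀ n → ‖ z ^ n ‖≤ R.fromℕ ((2 ℕ.* b) ℕ.^ n)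
  ^-bound b z≤b zero    = ‖‖-resp-≈ refl (R.sym (R.+-identityʳ R.1#)) ‖‖-1
  ^-bound b z≤b (suc n) = ‖‖-resp-≈ refl eq (‖‖-* z≤b (^-bound b z≤b n))
    where
    x = (2 ℕ.* b) ℕ.^ n
    eq : R.fromℕ b R.* R.fromℕ x R.+ R.fromℕ b R.* R.fromℕ x R.≈ R.fromℕ (2 ℕ.* b ℕ.* x)
    eq = R.trans (R.sym (R.trans (R.fromℕ-+-homo (b ℕ.* x) (b ℕ.* x))
           (R.+-cong (R.fromℕ-*-homo b x) (R.fromℕ-*-homo b x))))
         (R.reflexive (≡.cong R.fromℕ (≡.trans (≡.cong (b ℕ.* x ℕ.+_) (≡.sym (ℕ.+-identityʳ (b ℕ.* x))))
           (≡.sym (ℕ.*-assoc 2 b x)))))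

  term-bound : ∀ z → ∃ λ K → R.0# ≤ K × (∀ k → ‖ term z k ‖≤ K R.* (½ R.^ k R.* ½ R.^ k))
  term-bound z =
    let (b , z≤1+b) = ‖‖-∃-bound z
        m = 4 ℕ.* (2 ℕ.* suc b)
    in R.fromℕ (m ℕ.^ m) , R.fromℕ-nonneg (m ℕ.^ m) , λ k →
       ‖‖-weaken (power/factorial≤ (2 ℕ.* suc b) k) (‖‖-ι* (1/!-nonneg k) (^-bound (suc b) z≤1+b k))

  term-tail : ∀ z → ∃ λ R → ∀ n d → ‖ Σ< (n ℕ.+ d) (term z) - Σ< n (term z) ‖≤ R R.* ½ R.^ n
  term-tail z =
    let (K , 0≤K , bound) = term-bound z
    in K R.+ K , Σ<-tail 0≤K λ k → ‖‖-weaken (weaker K 0≤K k) (bound k)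
    where
    weaker : ∀ K → R.0# ≤ K → ∀ k → K R.* (½ R.^ k R.* ½ R.^ k) ≤ K R.* ½ R.^ k
    weaker K 0≤K k = R.*-monoˡ-≤ 0≤K
      (R.≤-resp-≈ R.refl (R.*-identityʳ (½ R.^ k)) (R.*-monoˡ-≤ (R.½^-nonneg k) (½^≤1 k)))

  -- A relation, because the values are not all constructed here: for z = i x the imaginary part of
  -- w has to be the given `sin x`.
  IsExp : Carrier → Carrier → Set (c ⊔ ℓ₃)
  IsExp z w = ∃ λ R → ∀ n → ‖ Σ< n (term z) - w ‖≤ R R.* ½ R.^ n

  isExp-unique : ∀ {z w w′} → IsExp z w → IsExp z w′ → w ≈ w′
  isExp-unique {z} {w} {w′} (R , S→w) (R′ , S→w′) = x-y≈0⇒x≈y (‖‖-squeeze λ n →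
    ‖‖-resp-≈ (solve 3 (λ s w w′ → (s :- w′) :- (s :- w) := w :- w′) refl (Σ< n (term z)) w w′)
      (R.sym (R.distribʳ _ R′ R)) (‖‖-- (S→w′ n) (S→w n)))

  isExp-cong : ∀ {z z′ w} → z ≈ z′ → IsExp z w → IsExp z′ w
  isExp-cong z≈z′ (R , S→w) = R , λ n → ‖‖-resp-≈ (+-congʳ (Σ<-cong n (term-cong z≈z′))) R.refl (S→w n)

  isExp-0 : IsExp 0# 1#
  isExp-0 = R.1# , S→1
    where
    S≈1 : ∀ n → Σ< (suc n) (term 0#) - 1# ≈ 0#
    S≈1 n = trans (+-congʳ (trans (+-cong (term-0 0#)
        (trans (Σ<-cong n λ k → trans (*-congˡ (zeroˡ _)) (zeroʳ _)) (Σ<-0 n))) (+-identityʳ 1#)))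
      (-‿inverseʳ 1#)
    S→1 : ∀ n → ‖ Σ< n (term 0#) - 1# ‖≤ R.1# R.* ½ R.^ n
    -- Only the empty sum is off, by 1; hence the constant 1.
    S→1 zero    = ‖‖-resp-≈ (sym (+-identityˡ _)) (R.sym (R.*-identityʳ R.1#)) (‖‖-neg ‖‖-1)
    S→1 (suc n) = ‖‖-resp-≈ (sym (S≈1 n)) R.refl
      (‖‖-0 (R.*-nonneg (R.<⇒≤ R.0<1) (R.½^-nonneg (suc n))))

  -- With S and T the partial sums at z and z + z′, the difference w″ - w w′ is (S - w) w′ - (S w′ -
  -- T) - (T - w″). The middle term is the error of the Cauchy product, because T sums the entries
  -- of `term z ⋆ term z′`.
  isExp-+ : ∀ {z z′ w w′ w″} → IsExp z w → IsExp z′ w′ → IsExp (z + z′) w″ → w″ ≈ w * w′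
  isExp-+ {z} {z′} {w} {w′} {w″} (R , S→w) (R′ , S→w′) (R″ , S→w″) =
    let (K , 0≤K , bound) = term-bound z
        (b , w′≤1+b) = ‖‖-∃-bound w′
        B = R.fromℕ (suc b)
    in x-y≈0⇒x≈y (‖‖-squeeze λ n →
      let ε = ½ R.^ n in
      ‖‖-resp-≈
        (trans (+-congʳ (+-congˡ (-‿cong (+-congˡ (-‿cong (Σ<-cong n (term-+ z z′)))))))
          (solve 5 (λ s t w w′ w″ → ((s :- w) :* w′ :- (s :* w′ :- t)) :- (t :- w″) := w″ :- w :* w′)
            refl (Σ< n (term z)) (Σ< n (term (z + z′))) w w′ w″))
        (product-rate R B R′ K R″ ε)
        (‖‖-- (‖‖-- (‖‖-* (S→w n) w′≤1+b) (Σ<-⋆-bound S→w′ n 0≤K bound)) (S→w″ n)))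

-- The complex numbers with the maximum norm.

module ComplexNumbers (ℝ : RealNumbers c ℓ₁ ℓ₂ ℓ₃) where

  open RealNumbers ℝ
  open RealProperties ℝ
  open RealOrder ℝ
  open IntegerCoefficients commutativeRing
  open Complexification commutativeRing using (complexRing)

  ∣∣-ι* : ∀ {r x s} → 0# ≤ r → ∣ x ∣≤ s → ∣ r * x ∣≤ (r * s)
  ∣∣-ι* 0≤r x≤s = ∣∣-* (∣∣-nonneg 0≤r (≤-reflexive refl)) x≤s

  ‖_‖≤_ : Carrier × Carrier → Carrier → Set ℓ₃
  ‖ x , y ‖≤ r = ∣ x ∣≤ r × ∣ y ∣≤ r

  abstract
    isNormed-ℂ : IsNormed ℝ complexRing ‖_‖≤_ (_, 0#)
    isNormed-ℂ = record
      { ‖‖-resp-≈  = λ (p , q) r≈s (a , b) → ∣∣-resp-≈ p r≈s a , ∣∣-resp-≈ q r≈s b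
      ; ‖‖-weaken  = λ r≤s (a , b) → ∣∣-weaken r≤s a , ∣∣-weaken r≤s b
      ; ‖‖-neg     = λ (a , b) → ∣∣-neg a , ∣∣-neg b
      ; ‖‖-+       = λ (a , b) (a′ , b′) → ∣∣-+ a a′ , ∣∣-+ b b′
      ; ‖‖-*       = λ (a , b) (a′ , b′) → ∣∣-- (∣∣-* a a′) (∣∣-* b b′) , ∣∣-+ (∣∣-* a b′) (∣∣-* b a′)
      ; ‖‖⇒0≤      = λ (a , _) → ∣∣⇒0≤ a
      ; ‖‖-0       = λ 0≤r → ∣∣-0 refl 0≤r , ∣∣-0 refl 0≤r
      ; ‖‖-1       = ∣∣-nonneg (<⇒≤ 0<1) (≤-reflexive refl) , ∣∣-0 refl (<⇒≤ 0<1)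
      ; ‖‖-squeeze = λ bound → squeeze (λ n → proj₁ (bound n)) , squeeze (λ n → proj₂ (bound n))
      ; ‖‖-∃-bound = λ (x , y) →
          let (m , p) = ∃-bound x
              (n , q) = ∃-bound y
          in m ℕ.+ n ,
             ( ∣∣-weaken (fromℕ-mono-≤ (ℕ.m≤n⇒m≤1+n (ℕ.m≤m+n m n))) p
             , ∣∣-weaken (fromℕ-mono-≤ (ℕ.m≤n⇒m≤1+n (ℕ.m≤n+m n m))) q)
      ; ι-cong     = _, refl
      ; ι-+        = λ r s → refl , sym (+-identityˡ 0#)
      ; ι-*        = λ r s →
          solve 2 (λ r s → r :* s := r :* s :- con (+ 0) :* con (+ 0)) refl r s ,
          solve 2 (λ r s → con (+ 0) := r :* con (+ 0) :+ con (+ 0) :* s) refl r s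
      ; ι-0        = refl , refl
      ; ι-1        = refl , refl
      ; ‖‖-ι*      = λ {r} {z} {s} 0≤r (a , b) →
          ∣∣-resp-≈ (solve 3 (λ r x y → r :* x := r :* x :- con (+ 0) :* y) refl r (proj₁ z) (proj₂ z))
            refl (∣∣-ι* 0≤r a) ,
          ∣∣-resp-≈ (solve 3 (λ r x y → r :* y := r :* y :+ con (+ 0) :* x) refl r (proj₁ z) (proj₂ z))
            refl (∣∣-ι* 0≤r b)
      }

  complexAlgebra : NormedAlgebra ℝ
  complexAlgebra = record { isNormed = isNormed-ℂ }

-- The sine as imaginary part of exp (i x).

module Trigonometry (ℝ : RealNumbers c ℓ₁ ℓ₂ ℓ₃) where

  open RealNumbers ℝ
  open RealProperties ℝ
  open RealOrder ℝ
  open FastConvergence ℝ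
  open Factorials ℝ
  open IntegerCoefficients commutativeRing
  open RingProperties ring using (-0#≈0#)
  open Complexification commutativeRing using (complexRing)
  open ComplexNumbers ℝ
  open Exponential complexAlgebra
  open PowerSeries complexRing using (Σ<; Σ<-cong)

  module ℂ = CommutativeRing complexRing
  open SemiringExp ℂ.semiring public using () renaming (_^_ to _^ᶜ_)

  ℂ : Set _
  ℂ = ℂ.Carrier

  Im-Σ< : ∀ (f : ℕ → ℂ) (g : ℕ → Carrier) →
          (∀ k → proj₂ (f (double k)) ≈ 0#) → (∀ k → proj₂ (f (suc (double k))) ≈ g k) →
          ∀ n → proj₂ (Σ< (double n) f) ≈ sum {n} (g ∘ toℕ)
  Im-Σ< f g even odd zero    = refl
  Im-Σ< f g even odd (suc n) = begin
    proj₂ (f 0) + (proj₂ (f 1) + proj₂ (Σ< (double n) (f ∘ suc ∘ suc)))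
      ≈⟨ +-cong (even 0) (+-cong (odd 0) (Im-Σ< (f ∘ suc ∘ suc) (g ∘ suc)
           (λ k → even (suc k)) (λ k → odd (suc k)) n)) ⟩
    0# + (g 0 + sum {n} (λ i → g (suc (toℕ i))))
      ≈⟨ +-identityˡ _ ⟩
    g 0 + sum {n} (λ i → g (suc (toℕ i)))  ∎
    where open SetoidReasoning (CommutativeRing.setoid commutativeRing)

  i*_ : Carrier → ℂ
  i* x = 0# , x

  i*^double : ∀ x k → (i* x) ^ᶜ double k ℂ.≈ ((- 1#) ^ k * x ^ double k , 0#)
  i*^double x zero    = sym (*-identityˡ 1#) , refl
  i*^double x (suc k) = ℂ.trans
    (ℂ.*-congˡ {i* x} (ℂ.*-congˡ {i* x} (i*^double x k)))
    ( solve 3 (λ x s p → con (+ 0) :* (con (+ 0) :* (s :* p) :- x :* con (+ 0)) :-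
                         x :* (con (+ 0) :* con (+ 0) :+ x :* (s :* p)) :=
                         (:- con (+ 1)) :* s :* (x :* (x :* p))) refl x ((- 1#) ^ k) (x ^ double k)
    , solve 3 (λ x s p → con (+ 0) :* (con (+ 0) :* con (+ 0) :+ x :* (s :* p)) :+
                         x :* (con (+ 0) :* (s :* p) :- x :* con (+ 0)) := con (+ 0))
        refl x ((- 1#) ^ k) (x ^ double k))

  i*^suc-double : ∀ x k → (i* x) ^ᶜ suc (double k) ℂ.≈ (0# , (- 1#) ^ k * x ^ suc (double k))
  i*^suc-double x k = ℂ.trans (ℂ.*-congˡ {i* x} (i*^double x k))
    ( solve 3 (λ x s p → con (+ 0) :* (s :* p) :- x :* con (+ 0) := con (+ 0))
        refl x ((- 1#) ^ k) (x ^ double k)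
    , solve 3 (λ x s p → con (+ 0) :* con (+ 0) :+ x :* (s :* p) := s :* (x :* p))
        refl x ((- 1#) ^ k) (x ^ double k))

  Im-term-double : ∀ x k → proj₂ (term (i* x) (double k)) ≈ 0#
  Im-term-double x k = trans (proj₂ (ℂ.*-congˡ {1/ double k ! , 0#} (i*^double x k)))
    (solve 2 (λ u v → u :* con (+ 0) :+ con (+ 0) :* v := con (+ 0)) refl
      (1/ double k !) ((- 1#) ^ k * x ^ double k))

  open Sine ℝ using (sineTerm; sinePartialSum)

  Im-term-suc-double : ∀ x k → proj₂ (term (i* x) (suc (double k))) ≈ sineTerm x k
  Im-term-suc-double x k = trans (proj₂ (ℂ.*-congˡ {1/ suc (double k) ! , 0#} (i*^suc-double x k)))
    (trans
      (solve 2 (λ u v → u :* v :+ con (+ 0) :* con (+ 0) := v :* u) refl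
        (1/ suc (double k) !) ((- 1#) ^ k * x ^ suc (double k)))
      (reindex (≡.trans (≡.cong suc (≡.sym (2*n≡double k))) (ℕ.+-comm 1 (2 ℕ.* k)))
        {{(2 ℕ.* k ℕ.+ 1) ℕ.!≢0}}))
    where
    reindex : ∀ {m n} → m ≡ n → .{{_ : NonZero (n !)}} →
              (- 1#) ^ k * x ^ m * 1/ m ! ≈ (- 1#) ^ k * x ^ n * recip (n !)
    reindex {m} ≡.refl = *-congˡ (1/!-recip m)

  Im-exp-sum : ∀ x n → sinePartialSum x n ≈ proj₂ (Σ< (double n) (term (i* x)))
  Im-exp-sum x n = sym (Im-Σ< (term (i* x)) (sineTerm x) (Im-term-double x) (Im-term-suc-double x) n)

  S : Carrier → ℕ → ℂ
  S x n = Σ< n (term (i* x))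

  S-tail : ∀ x → ∃ λ R → (∀ n d → ∣ proj₁ (S x (n ℕ.+ d)) - proj₁ (S x n) ∣≤ (R * ½ ^ n)) ×
                         (∀ n d → ∣ proj₂ (S x (n ℕ.+ d)) - proj₂ (S x n) ∣≤ (R * ½ ^ n))
  S-tail x = let (R , tail) = term-tail (i* x) in R , (λ n d → proj₁ (tail n d)) , (λ n d → proj₂ (tail n d))

  S-isExp : ∀ {x R cos sin} → (∀ n → ∣ proj₁ (S x n) - cos ∣≤ (R * ½ ^ n)) →
            (∀ n → ∣ proj₂ (S x n) - sin ∣≤ (R * ½ ^ n)) → IsExp (i* x) (cos , sin)
  S-isExp {R = R} re im = R , λ n → re n , im n

  re-S : ∀ x → ℕ → Carrier
  re-S x n = proj₁ (S x n)

  im-S : ∀ x → ℕ → Carrier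
  im-S x n = proj₂ (S x n)

  -- The real part is a new limit, supplied by completeness. The imaginary part is known to tend to
  -- `sin x` only along even indices, which `fast-limit` extends to all of them.
  isExp-exists : ∀ {sin} → IsSine ℝ sin → ∀ x → ∃ λ cos → IsExp (i* x) (cos , sin x)
  isExp-exists isSine x =
    let (R , re-fast , im-fast) = S-tail x
        (cos , re→cos) = complete (re-S x ∘ double) (fast⇒cauchy {re-S x} re-fast double n≤double)
    in cos , S-isExp
       (fast-limit {re-S x} re-fast double n≤double {l = cos} (λ _ → refl) re→cos)
       (fast-limit {im-S x} im-fast double n≤double (Im-exp-sum x) (isSine x))

  conj : ℂ → ℂ
  conj (x , y) = x , - y

  conj-* : ∀ z w → conj (z ℂ.* w) ℂ.≈ conj z ℂ.* conj w
  conj-* (x , y) (x′ , y′) =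
    solve 4 (λ x y x′ y′ → x :* x′ :- y :* y′ := x :* x′ :- (:- y) :* (:- y′)) refl x y x′ y′ ,
    solve 4 (λ x y x′ y′ → :- (x :* y′ :+ y :* x′) := x :* (:- y′) :+ (:- y) :* x′) refl x y x′ y′

  conj-^ : ∀ z n → conj (z ^ᶜ n) ℂ.≈ conj z ^ᶜ n
  conj-^ z zero    = refl , -0#≈0#
  conj-^ z (suc n) = ℂ.trans (conj-* z (z ^ᶜ n)) (ℂ.*-congˡ {conj z} (conj-^ z n))

  conj-term : ∀ z k → conj (term z k) ℂ.≈ term (conj z) k
  conj-term z k = ℂ.trans (conj-* _ (z ^ᶜ k)) (ℂ.*-cong {_} {1/ k ! , 0#} (refl , -0#≈0#) (conj-^ z k))

  conj-Σ< : ∀ n f → conj (Σ< n f) ℂ.≈ Σ< n (conj ∘ f)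
  conj-Σ< zero    f = refl , -0#≈0#
  conj-Σ< (suc n) f = ℂ.trans
    (refl , solve 2 (λ x y → :- (x :+ y) := :- x :+ (:- y)) refl (proj₂ (f 0)) (proj₂ (Σ< n (f ∘ suc))))
    (ℂ.+-congˡ {conj (f 0)} (conj-Σ< n (f ∘ suc)))

  isExp-conj : ∀ {z w} → IsExp z w → IsExp (conj z) (conj w)
  isExp-conj {z} {w} (R , S→w) = R , λ n →
    let (Re≈ , Im≈) = ℂ.trans (conj-Σ< n (term z)) (Σ<-cong n (conj-term z))
        (re , im) = S→w n
    in ∣∣-resp-≈ (+-congʳ Re≈) refl re ,
       ∣∣-resp-≈ (trans (solve 2 (λ x y → :- (x :- y) := :- x :- (:- y)) refl
                          (proj₂ (Σ< n (term z))) (proj₂ w))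
                   (+-congʳ Im≈)) refl (∣∣-neg im)

  -- The real part of exp (i x) exp (- i x) = exp 0, where the second factor is the conjugate of the
  -- first.
  exp-norm : ∀ {x cos sin} → IsExp (i* x) (cos , sin) → cos * cos + sin * sin ≈ 1#
  exp-norm {x} {cos} {sin} e = trans
    (solve 2 (λ c s → c :* c :+ s :* s := c :* c :- s :* (:- s)) refl cos sin)
    (sym (proj₁ (isExp-+ e (isExp-conj e) (isExp-cong (sym (+-identityʳ 0#) , sym (-‿inverseʳ x)) isExp-0))))

  module _ {sin : Carrier → Carrier} (isSine : IsSine ℝ sin) where

    exp-multiple : ∀ {θ w} → IsExp (i* θ) w → ∀ n {y w′} → y ≈ fromℕ n * θ → IsExp (i* y) w′ → w′ ℂ.≈ w ^ᶜ n
    exp-multiple {θ} e zero y≈nθ e′ =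
      isExp-unique e′ (isExp-cong (refl , sym (trans y≈nθ (zeroˡ θ))) isExp-0)
    exp-multiple {θ} {w} e (suc n) y≈nθ e′ =
      let (cos , e″) = isExp-exists isSine (fromℕ n * θ)
      in ℂ.trans
           (isExp-+ e e″ (isExp-cong
             ( sym (+-identityʳ 0#)
             , trans y≈nθ (trans (distribʳ θ 1# (fromℕ n)) (+-congʳ (*-identityˡ θ)))) e′))
           (ℂ.*-congˡ {w} (exp-multiple e n refl e″))

    sin-multiples : ∀ θ → ∃ λ cos → cos * cos + sin θ * sin θ ≈ 1# ×
                    (∀ n {y} → y ≈ fromℕ n * θ → sin y ≈ proj₂ ((cos , sin θ) ^ᶜ n))
    sin-multiples θ =
      let (cos , e) = isExp-exists isSine θ
      in cos , exp-norm e , λ n {y} y≈nθ → proj₂ (exp-multiple e n y≈nθ (proj₂ (isExp-exists isSine y)))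

-- Golden ratio, Binet's formulas and powers of conjugates.

-- (p , q) stands for p + q φ, where φ² = φ + 1.
ℤ[φ] : Set
ℤ[φ] = ℤ × ℤ

infixl 7 _⊗_
_⊗_ : ℤ[φ] → ℤ[φ] → ℤ[φ]
(p , q) ⊗ (p′ , q′) = p ℤ.* p′ ℤ.+ q ℤ.* q′ , p ℤ.* q′ ℤ.+ q ℤ.* p′ ℤ.+ q ℤ.* q′

infixl 6 _⊖_
_⊖_ : ℤ[φ] → ℤ[φ] → ℤ[φ]
(p , q) ⊖ (p′ , q′) = p ℤ.- p′ , q ℤ.- q′

-- ψ = 1 - φ is the other root of t² = t + 1, and δ = φ - ψ = 2 φ - 1 has square 5.
φ̂ ψ̂ δ̂ : ℤ[φ]
φ̂ = + 0 , + 1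
ψ̂ = + 1 , ℤ.- + 1
δ̂ = φ̂ ⊖ ψ̂

IsGolden : (R : CommutativeRing c ℓ) → CommutativeRing.Carrier R → Set ℓ
IsGolden R φ = φ * φ ≈ φ + 1#
  where open CommutativeRing R

module GoldenRatio (ℝ : RealNumbers c ℓ₁ ℓ₂ ℓ₃) (φ : RealNumbers.Carrier ℝ)
  (φ²≈φ+1 : IsGolden (RealNumbers.commutativeRing ℝ) φ) where

  open RealNumbers ℝ
  open RealOrder ℝ
  open IntegerCoefficients commutativeRing
  open SemiringExp semiring using (^-congˡ; ^-assocʳ)
  open CommutativeSemiringExp (CommutativeRing.commutativeSemiring commutativeRing) using (^-distrib-*)
  open SetoidReasoning (CommutativeRing.setoid commutativeRing)

  ⟦_⟧ : ℤ[φ] → Carrier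
  ⟦ p , q ⟧ = fromℤ p + fromℤ q * φ

  ⟦⟧-⊖ : ∀ x y → ⟦ x ⊖ y ⟧ ≈ ⟦ x ⟧ - ⟦ y ⟧
  ⟦⟧-⊖ (p , q) (p′ , q′) = trans
    (+-cong (minus p p′) (*-congʳ (minus q q′)))
    (solve 5 (λ p q p′ q′ φ → (p :- p′) :+ (q :- q′) :* φ := (p :+ q :* φ) :- (p′ :+ q′ :* φ)) refl
      (fromℤ p) (fromℤ q) (fromℤ p′) (fromℤ q′) φ)
    where
    minus : ∀ i j → fromℤ (i ℤ.- j) ≈ fromℤ i - fromℤ j
    minus i j = trans (fromℤ-+-homo i (ℤ.- j)) (+-congˡ (fromℤ-‿homo j))

  ⟦⟧-⊗ : ∀ x y → ⟦ x ⊗ y ⟧ ≈ ⟦ x ⟧ * ⟦ y ⟧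
  ⟦⟧-⊗ (p , q) (p′ , q′) = begin
    ⟦ (p , q) ⊗ (p′ , q′) ⟧
      ≈⟨ +-cong
           (trans (fromℤ-+-homo (p ℤ.* p′) (q ℤ.* q′)) (+-cong (fromℤ-*-homo p p′) (fromℤ-*-homo q q′)))
           (*-congʳ (trans (fromℤ-+-homo (p ℤ.* q′ ℤ.+ q ℤ.* p′) (q ℤ.* q′))
             (+-cong (trans (fromℤ-+-homo (p ℤ.* q′) (q ℤ.* p′)) (+-cong (fromℤ-*-homo p q′) (fromℤ-*-homo q p′)))
                     (fromℤ-*-homo q q′)))) ⟩
    (a * a′ + b * b′) + (a * b′ + b * a′ + b * b′) * φ
      ≈⟨ solve 5 (λ a b a′ b′ φ →
           (a :* a′ :+ b :* b′) :+ (a :* b′ :+ b :* a′ :+ b :* b′) :* φ :=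
           a :* a′ :+ (a :* b′ :+ b :* a′) :* φ :+ b :* b′ :* (φ :+ con (+ 1))) refl a b a′ b′ φ ⟩
    a * a′ + (a * b′ + b * a′) * φ + b * b′ * (φ + 1#)
      ≈⟨ +-congˡ (*-congˡ φ²≈φ+1) ⟨
    a * a′ + (a * b′ + b * a′) * φ + b * b′ * (φ * φ)
      ≈⟨ solve 5 (λ a b a′ b′ φ →
           a :* a′ :+ (a :* b′ :+ b :* a′) :* φ :+ b :* b′ :* (φ :* φ) :=
           (a :+ b :* φ) :* (a′ :+ b′ :* φ)) refl a b a′ b′ φ ⟩
    ⟦ p , q ⟧ * ⟦ p′ , q′ ⟧ ∎
    where
    a = fromℤ p
    b = fromℤ q
    a′ = fromℤ p′
    b′ = fromℤ q′

  ψ δ : Carrier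
  ψ = ⟦ ψ̂ ⟧
  δ = ⟦ δ̂ ⟧

  ⟦φ̂⟧≈φ : ⟦ φ̂ ⟧ ≈ φ
  ⟦φ̂⟧≈φ = trans (+-identityˡ _) (*-identityˡ φ)

  δ≈φ-ψ : δ ≈ φ - ψ
  δ≈φ-ψ = trans (⟦⟧-⊖ φ̂ ψ̂) (+-congʳ ⟦φ̂⟧≈φ)

  ⟦n⟧≈fromℕ : ∀ n → ⟦ + n , + 0 ⟧ ≈ fromℕ n
  ⟦n⟧≈fromℕ n = trans (+-congˡ (zeroˡ φ)) (trans (+-identityʳ _) (sym (fromℕ-fromℤ n)))

  δ²≈5 : δ * δ ≈ fromℕ 5
  δ²≈5 = trans (sym (⟦⟧-⊗ δ̂ δ̂)) (⟦n⟧≈fromℕ 5)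

  φ^-rec : ∀ n → φ ^ suc (suc n) ≈ φ ^ suc n + φ ^ n
  φ^-rec n = begin
    φ * (φ * φ ^ n)       ≈⟨ *-assoc φ φ _ ⟨
    φ * φ * φ ^ n         ≈⟨ *-congʳ φ²≈φ+1 ⟩
    (φ + 1#) * φ ^ n      ≈⟨ distribʳ _ φ 1# ⟩
    φ * φ ^ n + 1# * φ ^ n  ≈⟨ +-congˡ (*-identityˡ _) ⟩
    φ * φ ^ n + φ ^ n     ∎

  ψ²≈ψ+1 : ψ * ψ ≈ ψ + 1#
  ψ²≈ψ+1 = trans (sym (⟦⟧-⊗ ψ̂ ψ̂))
    (solve 1 (λ φ → con (+ 2) :+ con -[1+ 0 ] :* φ := (con (+ 1) :+ con -[1+ 0 ] :* φ) :+ con (+ 1)) refl φ)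

  ψ^-rec : ∀ n → ψ ^ suc (suc n) ≈ ψ ^ suc n + ψ ^ n
  ψ^-rec n = begin
    ψ * (ψ * ψ ^ n)       ≈⟨ *-assoc ψ ψ _ ⟨
    ψ * ψ * ψ ^ n         ≈⟨ *-congʳ ψ²≈ψ+1 ⟩
    (ψ + 1#) * ψ ^ n      ≈⟨ distribʳ _ ψ 1# ⟩
    ψ * ψ ^ n + 1# * ψ ^ n  ≈⟨ +-congˡ (*-identityˡ _) ⟩
    ψ * ψ ^ n + ψ ^ n     ∎

  binet-L : ∀ n → fromℕ (L n) ≈ φ ^ n + ψ ^ n
  binet-L zero          = +-congˡ (+-identityʳ 1#)
  binet-L (suc zero)    = trans (fromℕ-fromℤ 1)
    (solve 1 (λ φ → con (+ 1) := φ :* con (+ 1) :+ (con (+ 1) :+ con -[1+ 0 ] :* φ) :* con (+ 1)) refl φ)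
  binet-L (suc (suc n)) = begin
    fromℕ (L (suc n) ℕ.+ L n)                        ≈⟨ fromℕ-+-homo (L (suc n)) (L n) ⟩
    fromℕ (L (suc n)) + fromℕ (L n)                  ≈⟨ +-cong (binet-L (suc n)) (binet-L n) ⟩
    (φ ^ suc n + ψ ^ suc n) + (φ ^ n + ψ ^ n)
      ≈⟨ solve 4 (λ a b c d → (a :+ b) :+ (c :+ d) := (a :+ c) :+ (b :+ d)) refl
           (φ ^ suc n) (ψ ^ suc n) (φ ^ n) (ψ ^ n) ⟩
    (φ ^ suc n + φ ^ n) + (ψ ^ suc n + ψ ^ n)        ≈⟨ +-cong (φ^-rec n) (ψ^-rec n) ⟨
    φ ^ suc (suc n) + ψ ^ suc (suc n)                ∎

  -- Multiplied through by δ, so that no inverse of a square root of 5 is involved.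
  binet-F : ∀ n → δ * fromℕ (F n) ≈ φ ^ n - ψ ^ n
  binet-F zero          = trans (zeroʳ δ) (sym (-‿inverseʳ 1#))
  binet-F (suc zero)    = trans (*-cong δ≈φ-ψ (+-identityʳ 1#))
    (solve 2 (λ φ ψ → (φ :- ψ) :* con (+ 1) := φ :* con (+ 1) :- ψ :* con (+ 1)) refl φ ψ)
  binet-F (suc (suc n)) = begin
    δ * fromℕ (F (suc n) ℕ.+ F n)                    ≈⟨ *-congˡ (fromℕ-+-homo (F (suc n)) (F n)) ⟩
    δ * (fromℕ (F (suc n)) + fromℕ (F n))            ≈⟨ distribˡ δ _ _ ⟩
    δ * fromℕ (F (suc n)) + δ * fromℕ (F n)          ≈⟨ +-cong (binet-F (suc n)) (binet-F n) ⟩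
    (φ ^ suc n - ψ ^ suc n) + (φ ^ n - ψ ^ n)
      ≈⟨ solve 4 (λ a b c d → (a :- b) :+ (c :- d) := (a :+ c) :- (b :+ d)) refl
           (φ ^ suc n) (ψ ^ suc n) (φ ^ n) (ψ ^ n) ⟩
    (φ ^ suc n + φ ^ n) - (ψ ^ suc n + ψ ^ n)        ≈⟨ +-cong (φ^-rec n) (-‿cong (ψ^-rec n)) ⟨
    φ ^ suc (suc n) - ψ ^ suc (suc n)                ∎

  even-power : ∀ {x} → x * x ≈ fromℕ 5 → ∀ k → x ^ (2 ℕ.* k) ≈ fromℕ (5 ℕ.^ k)
  even-power {x} x²≈5 k = begin
    x ^ (2 ℕ.* k)    ≈⟨ ^-assocʳ x 2 k ⟨
    (x ^ 2) ^ k      ≈⟨ ^-congˡ k (trans (*-congˡ (*-identityʳ x)) x²≈5) ⟩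
    fromℕ 5 ^ k      ≈⟨ fromℕ-^-homo 5 k ⟨
    fromℕ (5 ℕ.^ k)  ∎

  -δ²≈5 : - δ * - δ ≈ fromℕ 5
  -δ²≈5 = trans (solve 1 (λ δ → (:- δ) :* (:- δ) := δ :* δ) refl δ) δ²≈5

  -- δ is a square root of 5, and ψ and - δ are the conjugates of φ and δ.
  conjugatePowers : ℕ → ℕ → Carrier
  conjugatePowers e n = (φ ^ e * δ) ^ n + (ψ ^ e * - δ) ^ n

  conjugatePowers-expand : ∀ e n → conjugatePowers e n ≈ φ ^ (e ℕ.* n) * δ ^ n + ψ ^ (e ℕ.* n) * (- δ) ^ n
  conjugatePowers-expand e n = +-cong
    (trans (^-distrib-* (φ ^ e) δ n) (*-congʳ (^-assocʳ φ e n)))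
    (trans (^-distrib-* (ψ ^ e) (- δ) n) (*-congʳ (^-assocʳ ψ e n)))

  -- For even n both δⁿ and (- δ)ⁿ are 5ᵏ, which leaves the sum in Binet's formula for Lucas
  -- numbers.
  conjugatePowers-even : ∀ e k → let n = 2 ℕ.* k in
    conjugatePowers e n ≈ fromℕ (5 ℕ.^ k) * fromℕ (L (e ℕ.* n))
  conjugatePowers-even e k = begin
    conjugatePowers e n                                ≈⟨ conjugatePowers-expand e n ⟩
    x * δ ^ n + y * (- δ) ^ n                          ≈⟨ +-cong (*-congˡ (even-power δ²≈5 k)) (*-congˡ (even-power -δ²≈5 k)) ⟩
    x * fromℕ (5 ℕ.^ k) + y * fromℕ (5 ℕ.^ k)          ≈⟨ distribʳ _ x y ⟨
    (x + y) * fromℕ (5 ℕ.^ k)                          ≈⟨ *-comm _ _ ⟩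
    fromℕ (5 ℕ.^ k) * (x + y)                          ≈⟨ *-congˡ (binet-L (e ℕ.* n)) ⟨
    fromℕ (5 ℕ.^ k) * fromℕ (L (e ℕ.* n))              ∎
    where
    n = 2 ℕ.* k
    x = φ ^ (e ℕ.* n)
    y = ψ ^ (e ℕ.* n)

  -- For odd n the powers of δ and - δ have opposite signs, which leaves δ 5ᵏ times a difference,
  -- that is δ² 5ᵏ times a Fibonacci number. The square of δ raises the exponent of 5 to k + 1.
  conjugatePowers-odd : ∀ e k → let n = suc (2 ℕ.* k) in
    conjugatePowers e n ≈ fromℕ (5 ℕ.^ suc k) * fromℕ (F (e ℕ.* n))
  conjugatePowers-odd e k = begin
    conjugatePowers e n                                ≈⟨ conjugatePowers-expand e n ⟩
    x * (δ * δ ^ (2 ℕ.* k)) + y * (- δ * (- δ) ^ (2 ℕ.* k))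
      ≈⟨ +-cong (*-congˡ (*-congˡ (even-power δ²≈5 k))) (*-congˡ (*-congˡ (even-power -δ²≈5 k))) ⟩
    x * (δ * p) + y * (- δ * p)
      ≈⟨ solve 4 (λ x y δ p → x :* (δ :* p) :+ y :* ((:- δ) :* p) := p :* (δ :* (x :- y))) refl x y δ p ⟩
    p * (δ * (x - y))                                  ≈⟨ *-congˡ (*-congˡ (binet-F (e ℕ.* n))) ⟨
    p * (δ * (δ * f))
      ≈⟨ solve 3 (λ p δ f → p :* (δ :* (δ :* f)) := (δ :* δ) :* p :* f) refl p δ f ⟩
    (δ * δ) * p * f                                    ≈⟨ *-congʳ (*-congʳ δ²≈5) ⟩
    fromℕ 5 * p * f                                    ≈⟨ *-congʳ (fromℕ-*-homo 5 (5 ℕ.^ k)) ⟨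
    fromℕ (5 ℕ.^ suc k) * f                            ∎
    where
    n = suc (2 ℕ.* k)
    x = φ ^ (e ℕ.* n)
    y = ψ ^ (e ℕ.* n)
    p = fromℕ (5 ℕ.^ k)
    f = fromℕ (F (e ℕ.* n))

-- Multiple-angle formulas for a unit complex number.

OnUnitCircle : (R : CommutativeRing c ℓ) → (x y : CommutativeRing.Carrier R) → Set ℓ
OnUnitCircle R x y = x * x + y * y ≈ 1#
  where open CommutativeRing R

module UnitComplexNumber (R : CommutativeRing c ℓ) (x y : CommutativeRing.Carrier R)
  (norm : OnUnitCircle R x y) where

  open CommutativeRing R
  open IntegerCoefficients R
  open SetoidReasoning setoid

  -- Real and imaginary part of (x + i y)ⁿ.
  Re Im : ℕ → Carrier
  Re zero    = 1#
  Re (suc n) = x * Re n - y * Im n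
  Im zero    = 0#
  Im (suc n) = x * Im n + y * Re n

  Re-+ : ∀ m n → Re (m ℕ.+ n) ≈ Re m * Re n - Im m * Im n
  Im-+ : ∀ m n → Im (m ℕ.+ n) ≈ Re m * Im n + Im m * Re n
  Re-+ zero    n = solve 2 (λ a b → a := con (+ 1) :* a :- con (+ 0) :* b) refl (Re n) (Im n)
  Re-+ (suc m) n = trans (+-cong (*-congˡ (Re-+ m n)) (-‿cong (*-congˡ (Im-+ m n))))
    (solve 6 (λ x y a b a′ b′ → x :* (a :* a′ :- b :* b′) :- y :* (a :* b′ :+ b :* a′) :=
        (x :* a :- y :* b) :* a′ :- (x :* b :+ y :* a) :* b′) refl x y (Re m) (Im m) (Re n) (Im n))
  Im-+ zero    n = solve 2 (λ a b → b := con (+ 1) :* b :+ con (+ 0) :* a) refl (Re n) (Im n)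
  Im-+ (suc m) n = trans (+-cong (*-congˡ (Im-+ m n)) (*-congˡ (Re-+ m n)))
    (solve 6 (λ x y a b a′ b′ → x :* (a :* b′ :+ b :* a′) :+ y :* (a :* a′ :- b :* b′) :=
        (x :* a :- y :* b) :* b′ :+ (x :* b :+ y :* a) :* a′) refl x y (Re m) (Im m) (Re n) (Im n))

  Re²+Im²≈1 : ∀ n → Re n * Re n + Im n * Im n ≈ 1#
  Re²+Im²≈1 zero    = solve 0 (con (+ 1) :* con (+ 1) :+ con (+ 0) :* con (+ 0) := con (+ 1)) refl
  Re²+Im²≈1 (suc n) = begin
    Re (suc n) * Re (suc n) + Im (suc n) * Im (suc n)
      ≈⟨ solve 4 (λ x y a b → (x :* a :- y :* b) :* (x :* a :- y :* b) :+ (x :* b :+ y :* a) :* (x :* b :+ y :* a) :=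
           (x :* x :+ y :* y) :* (a :* a :+ b :* b)) refl x y (Re n) (Im n) ⟩
    (x * x + y * y) * (Re n * Re n + Im n * Im n)  ≈⟨ *-cong norm (Re²+Im²≈1 n) ⟩
    1# * 1#                                        ≈⟨ *-identityˡ 1# ⟩
    1#                                             ∎

  -- 2 Re (x + i y)²ⁿ
  X : ℕ → Carrier
  X n = let d = Re n * Re n - Im n * Im n in d + d

  φ : Carrier
  φ = let d = x * x - y * y in d + d

  X-0 : X 0 ≈ 1# + 1#
  X-0 = solve 0 (let d = con (+ 1) :* con (+ 1) :- con (+ 0) :* con (+ 0) in d :+ d := con (+ 2)) refl

  X-1 : X 1 ≈ φ
  X-1 = solve 2 (λ x y → let a = x :* con (+ 1) :- y :* con (+ 0)
                             b = x :* con (+ 0) :+ y :* con (+ 1)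
                             d = a :* a :- b :* b
                             e = x :* x :- y :* y in d :+ d := e :+ e) refl x y

  -- For z = x + i y, multiply z² + z̄² = φ by z to the power 2 n + 2 and take real parts. The
  -- identity given to the solver keeps N = x² + y² as a factor; `norm` removes it afterwards.
  X-rec : ∀ n → X (suc (suc n)) ≈ φ * X (suc n) - X n
  X-rec n = begin
    X (suc (suc n))
      ≈⟨ solve 4 (λ x y a b →
           let a′ = x :* a :- y :* b
               b′ = x :* b :+ y :* a
               a″ = x :* a′ :- y :* b′
               b″ = x :* b′ :+ y :* a′
               e = x :* x :- y :* y
               N = x :* x :+ y :* y
               X₀ = a :* a :- b :* b
               X₁ = a′ :* a′ :- b′ :* b′
               X₂ = a″ :* a″ :- b″ :* b″
           in X₂ :+ X₂ := (e :+ e) :* (X₁ :+ X₁) :- N :* N :* (X₀ :+ X₀)) refl x y (Re n) (Im n) ⟩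
    φ * X (suc n) - (x * x + y * y) * (x * x + y * y) * X n
      ≈⟨ +-congˡ (-‿cong (trans (*-congʳ (trans (*-cong norm norm) (*-identityˡ 1#))) (*-identityˡ (X n)))) ⟩
    φ * X (suc n) - X n ∎

  -- The half-angle formula 4 sin² t = 2 - 2 cos 2t.
  4*Im² : ∀ n → fromℤ (+ 4) * (Im n * Im n) ≈ (1# + 1#) - X n
  4*Im² n = begin
    fromℤ (+ 4) * (Im n * Im n)
      ≈⟨ solve 2 (λ a b → con (+ 4) :* (b :* b) :=
           con (+ 2) :* (a :* a :+ b :* b) :- ((a :* a :- b :* b) :+ (a :* a :- b :* b))) refl (Re n) (Im n) ⟩
    fromℤ (+ 2) * (Re n * Re n + Im n * Im n) - X n  ≈⟨ +-congʳ (trans (*-congˡ (Re²+Im²≈1 n)) (*-identityʳ _)) ⟩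
    (1# + 1#) - X n  ∎

  -- The Chebyshev identity cos 5t = cos t (16 cos⁴ t - 20 cos² t + 5), rewritten with 4 cos² t = φ
  -- + 2.
  Re-5 : Re 5 ≈ x * (φ * φ - φ - 1#)
  Re-5 = begin
    Re 5
      ≈⟨ solve 2 (λ x y →
           let re = λ a b → x :* a :- y :* b
               im = λ a b → x :* b :+ y :* a
               a₁ = re (con (+ 1)) (con (+ 0)) ; b₁ = im (con (+ 1)) (con (+ 0))
               a₂ = re a₁ b₁ ; b₂ = im a₁ b₁
               a₃ = re a₂ b₂ ; b₃ = im a₂ b₂
               a₄ = re a₃ b₃ ; b₄ = im a₃ b₃
               e = x :* x :- y :* y
               N = x :* x :+ y :* y
           in re a₄ b₄ := x :* ((e :+ e) :* (e :+ e) :- (e :+ e) :* N :- N :* N)) refl x y ⟩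
    x * (φ * φ - φ * N - N * N)
      ≈⟨ *-congˡ (+-cong (+-congˡ (-‿cong (trans (*-congˡ norm) (*-identityʳ φ))))
                         (-‿cong (trans (*-cong norm norm) (*-identityˡ 1#)))) ⟩
    x * (φ * φ - φ - 1#)  ∎
    where N = x * x + y * y

  Im-double : ∀ n → Im (n ℕ.+ n) ≈ Re n * (Im n + Im n)
  Im-double n = trans (Im-+ n n) (solve 2 (λ a b → a :* b :+ b :* a := a :* (b :+ b)) refl (Re n) (Im n))

-- For φ = 2 cos (π / 5), X̂ n is 2 cos (n π / 5), by the Chebyshev recursion.
X̂ : ℕ → ℤ[φ]
X̂ zero          = + 2 , + 0
X̂ (suc zero)    = φ̂
X̂ (suc (suc n)) = φ̂ ⊗ X̂ (suc n) ⊖ X̂ n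

4sin² : ℕ → ℤ[φ]
4sin² n = (+ 2 , + 0) ⊖ X̂ n

-- The angle π / 10 and the golden ratio.

module TenthRoot (ℝ : RealNumbers c ℓ₁ ℓ₂ ℓ₃) (x y : RealNumbers.Carrier ℝ)
  (norm : OnUnitCircle (RealNumbers.commutativeRing ℝ) x y) where

  open RealNumbers ℝ
  open RealProperties ℝ
  open RealOrder ℝ
  open IntegerCoefficients commutativeRing
  open UnitComplexNumber commutativeRing x y norm public
  open SetoidReasoning (CommutativeRing.setoid commutativeRing)

  xy≈0⇒x≈0 : ∀ {x y} → 0# < y → x * y ≈ 0# → x ≈ 0#
  xy≈0⇒x≈0 {x} {y} 0<y xy≈0 =
    *-cancelˡ-invertible (⁻¹-* y 0<y) (trans (*-comm y x) (trans xy≈0 (sym (zeroʳ y))))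

  module GoldenAngle (Im-10 : Im 10 ≈ 0#) (Im-5 : 0# < Im 5) (Im-2 : 0# < Im 2) where

    -- `Re-5` gives x q ≈ 0, and x must be cancelled. Positivity is at hand for sines but not for
    -- the cosine x, so x is completed to 2 x y = `Im 2`.
    φ²≈φ+1 : φ * φ ≈ φ + 1#
    φ²≈φ+1 = begin
      φ * φ                            ≈⟨ solve 1 (λ φ → φ :* φ := (φ :* φ :- φ :- con (+ 1)) :+ (φ :+ con (+ 1))) refl φ ⟩
      (φ * φ - φ - 1#) + (φ + 1#)      ≈⟨ +-congʳ (xy≈0⇒x≈0 Im-2 q*Im-2≈0) ⟩
      0# + (φ + 1#)                    ≈⟨ +-identityˡ _ ⟩
      φ + 1#                           ∎
      where
      q = φ * φ - φ - 1#
      Re-5≈0 : Re 5 ≈ 0#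
      Re-5≈0 = xy≈0⇒x≈0 (+-pos Im-5 Im-5) (trans (sym (Im-double 5)) Im-10)
      q*Im-2≈0 : q * Im 2 ≈ 0#
      q*Im-2≈0 = begin
        q * Im 2
          ≈⟨ solve 3 (λ q x y → let a = x :* con (+ 1) :- y :* con (+ 0)
                                    b = x :* con (+ 0) :+ y :* con (+ 1)
                                in q :* (x :* b :+ y :* a) := (x :* q) :* (y :+ y)) refl q x y ⟩
        (x * q) * (y + y)  ≈⟨ *-congʳ (trans (sym Re-5) Re-5≈0) ⟩
        0# * (y + y)       ≈⟨ zeroˡ _ ⟩
        0#                 ∎

    open GoldenRatio ℝ φ φ²≈φ+1 public

    ⟦X̂⟧≈X : ∀ n → ⟦ X̂ n ⟧ ≈ X n
    ⟦X̂⟧≈X zero          = trans (trans (+-congˡ (zeroˡ φ)) (+-identityʳ _)) (sym X-0)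
    ⟦X̂⟧≈X (suc zero)    = trans ⟦φ̂⟧≈φ (sym X-1)
    ⟦X̂⟧≈X (suc (suc n)) = begin
      ⟦ φ̂ ⊗ X̂ (suc n) ⊖ X̂ n ⟧         ≈⟨ ⟦⟧-⊖ (φ̂ ⊗ X̂ (suc n)) (X̂ n) ⟩
      ⟦ φ̂ ⊗ X̂ (suc n) ⟧ - ⟦ X̂ n ⟧     ≈⟨ +-cong (⟦⟧-⊗ φ̂ (X̂ (suc n))) (-‿cong (⟦X̂⟧≈X n)) ⟩
      ⟦ φ̂ ⟧ * ⟦ X̂ (suc n) ⟧ - X n     ≈⟨ +-congʳ (*-cong ⟦φ̂⟧≈φ (⟦X̂⟧≈X (suc n))) ⟩
      φ * X (suc n) - X n             ≈⟨ X-rec n ⟨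
      X (suc (suc n))                 ∎

    ⟦4sin²⟧ : ∀ n → ⟦ 4sin² n ⟧ ≈ fromℤ (+ 4) * (Im n * Im n)
    ⟦4sin²⟧ n = begin
      ⟦ 4sin² n ⟧                     ≈⟨ ⟦⟧-⊖ (+ 2 , + 0) (X̂ n) ⟩
      ⟦ + 2 , + 0 ⟧ - ⟦ X̂ n ⟧         ≈⟨ +-cong (trans (+-congˡ (zeroˡ φ)) (+-identityʳ _)) (-‿cong (⟦X̂⟧≈X n)) ⟩
      (1# + 1#) - X n                 ≈⟨ 4*Im² n ⟨
      fromℤ (+ 4) * (Im n * Im n)     ∎

-- Classification of the summands by computation in ℤ[φ].

infixr 8 _⊗^_
_⊗^_ : ℤ[φ] → ℕ → ℤ[φ]
x ⊗^ zero  = + 1 , + 0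
x ⊗^ suc n = x ⊗ (x ⊗^ n)

sumℕ : ∀ {n} → (Fin n → ℕ) → ℕ
sumℕ = Vector.foldr ℕ._+_ 0

φ-root ψ-root : ℕ → ℤ[φ]
φ-root e = (φ̂ ⊗^ e) ⊗ δ̂
ψ-root e = (ψ̂ ⊗^ e) ⊗ ((+ 0 , + 0) ⊖ δ̂)

-- For j + ℓ + k divisible by 10, 300 / (4sin² (jπ/10) · 4sin² (ℓπ/10) · 4sin² (kπ/10)) is some scale i · root i.
scale : Fin 8 → ℕ
scale = lookup (15 ∷ 15 ∷ 12 ∷ 12 ∷ 60 ∷ 60 ∷ 60 ∷ 60 ∷ [])

root : Fin 8 → ℤ[φ]
root = lookup (φ-root 1 ∷ ψ-root 1 ∷ φ-root 1 ∷ ψ-root 1 ∷ φ-root 1 ∷ ψ-root 1 ∷ φ-root 5 ∷ ψ-root 5 ∷ [])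

base : Fin 8 → ℤ[φ]
base i = (+ scale i , + 0) ⊗ root i

residue : Fin 9 → ℕ
residue j = suc (toℕ j)

sin²Product : (j ℓ k : Fin 9) → ℤ[φ]
sin²Product j ℓ k = 4sin² (residue j) ⊗ 4sin² (residue ℓ) ⊗ 4sin² (residue k)

infix 4 _≟_
_≟_ : (x y : ℤ[φ]) → Dec (x ≡ y)
_≟_ = ≡-dec ℤ._≟_ ℤ._≟_

-- The last index is returned untested when all others fail. `class-correct` checks the outcome for
-- every admissible triple.
search : ∀ {n} → (Fin (suc n) → Bool) → Fin (suc n)
search {zero}  p = Fin.zero
search {suc n} p = if p Fin.zero then Fin.zero else Fin.suc (search (p ∘ Fin.suc))

class : (j ℓ k : Fin 9) → Fin 8
class j ℓ k = search (λ i → does (base i ⊗ sin²Product j ℓ k ≟ (+ 300 , + 0)))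

admissible? : (j ℓ k : Fin 9) → Dec (10 ∣ residue j ℕ.+ residue ℓ ℕ.+ residue k)
admissible? j ℓ k = 10 ∣? residue j ℕ.+ residue ℓ ℕ.+ residue k

class-correct? : ∀ j ℓ k → Dec (10 ∣ residue j ℕ.+ residue ℓ ℕ.+ residue k →
                                base (class j ℓ k) ⊗ sin²Product j ℓ k ≡ (+ 300 , + 0))
class-correct? j ℓ k = admissible? j ℓ k →-dec (base (class j ℓ k) ⊗ sin²Product j ℓ k ≟ (+ 300 , + 0))

-- Evaluation over all 9³ triples. Equality of pairs in ℤ[φ] is decidable, unlike equality of the
-- reals they denote.
class-correct : ∀ j ℓ k → 10 ∣ residue j ℕ.+ residue ℓ ℕ.+ residue k →
                base (class j ℓ k) ⊗ sin²Product j ℓ k ≡ (+ 300 , + 0)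
class-correct = toWitness {a? = all? λ j → all? λ ℓ → all? λ k → class-correct? j ℓ k} _

unit : ∀ {n} → Fin n → Fin n → ℕ
unit Fin.zero    Fin.zero    = 1
unit Fin.zero    (Fin.suc _) = 0
unit (Fin.suc i) Fin.zero    = 0
unit (Fin.suc i) (Fin.suc j) = unit i j

multiplicity : Fin 8 → ℕ
multiplicity i = sumℕ λ j → sumℕ λ ℓ → sumℕ λ k →
  (if does (admissible? j ℓ k) then unit (class j ℓ k) else λ _ → 0) i

-- The entries add up to 72 = 81 - 9, the number of pairs j, ℓ with j + ℓ not divisible by 10.
-- Conjugate classes occur equally often, as multiplication by 3 modulo 10 exchanges them.
table : Fin 8 → ℕ
table = lookup (12 ∷ 12 ∷ 6 ∷ 6 ∷ 12 ∷ 12 ∷ 6 ∷ 6 ∷ [])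

multiplicities : ∀ i → multiplicity i ≡ table i
multiplicities = toWitness {a? = all? λ i → multiplicity i ℕ.≟ table i} _

-- Sums as linear combinations with counted coefficients.

module LinearCombinations (ℝ : RealNumbers c ℓ₁ ℓ₂ ℓ₃) {m : ℕ} (Y : Fin m → RealNumbers.Carrier ℝ) where

  open RealNumbers ℝ hiding (zero)
  open CommutativeMonoidSum (CommutativeRing.+-commutativeMonoid commutativeRing)
    using (sum-cong-≋; ∑-distrib-+; sum-replicate-zero)
  open SemiringMult semiring using (×-homo-+)

  -- Turns a sum of reals into a vector of multiplicities, so that like terms are counted in ℕ by
  -- evaluation.
  combination : (Fin m → ℕ) → Carrier
  combination v = sum λ i → v i · Y i

  combination-+ : ∀ v w → combination (λ i → v i ℕ.+ w i) ≈ combination v + combination w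
  combination-+ v w = trans (sum-cong-≋ λ i → ×-homo-+ (Y i) (v i) (w i))
    (∑-distrib-+ (λ i → v i · Y i) (λ i → w i · Y i))

  combination-cong : ∀ {v w} → (∀ i → v i ≡ w i) → combination v ≈ combination w
  combination-cong v≡w = sum-cong-≋ λ i → reflexive (≡.cong (_· Y i) (v≡w i))

  combination-0 : combination (λ _ → 0) ≈ 0#
  combination-0 = sum-replicate-zero m

  scaled-sum : ∀ {n} p (f : Fin n → Carrier) (v : Fin n → Fin m → ℕ) →
               (∀ j → p * f j ≈ combination (v j)) → p * sum f ≈ combination (λ i → sumℕ λ j → v j i)
  scaled-sum {zero}  p f v eq = trans (zeroʳ p) (sym combination-0)
  scaled-sum {suc n} p f v eq = trans (distribˡ p (f Fin.zero) (sum (f ∘ Fin.suc)))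
    (trans (+-cong (eq Fin.zero) (scaled-sum p (f ∘ Fin.suc) (v ∘ Fin.suc) (eq ∘ Fin.suc)))
      (sym (combination-+ (v Fin.zero) (λ i → sumℕ λ j → v (Fin.suc j) i))))

  scaled-triple-sum : ∀ {n₁ n₂ n₃} p (f : Fin n₁ → Fin n₂ → Fin n₃ → Carrier)
    (v : Fin n₁ → Fin n₂ → Fin n₃ → Fin m → ℕ) →
    (∀ j ℓ k → p * f j ℓ k ≈ combination (v j ℓ k)) →
    p * sum (λ j → sum λ ℓ → sum λ k → f j ℓ k) ≈
    combination (λ i → sumℕ λ j → sumℕ λ ℓ → sumℕ λ k → v j ℓ k i)
  scaled-triple-sum p f v eq =
    scaled-sum p (λ j → sum λ ℓ → sum λ k → f j ℓ k) (λ j i → sumℕ λ ℓ → sumℕ λ k → v j ℓ k i) λ j →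
    scaled-sum p (λ ℓ → sum λ k → f j ℓ k) (λ ℓ i → sumℕ λ k → v j ℓ k i) λ ℓ →
    scaled-sum p (f j ℓ) (v j ℓ) (eq j ℓ)

-- `Y` varies here because the induction passes to `Y ∘ Fin.suc`.
combination-unit : (ℝ : RealNumbers c ℓ₁ ℓ₂ ℓ₃) → let open RealNumbers ℝ in
                   ∀ {m} (Y : Fin m → Carrier) i → sum (λ j → unit i j · Y j) ≈ Y i
combination-unit ℝ Y Fin.zero    = trans
  (+-cong (+-identityʳ (Y Fin.zero)) (LinearCombinations.combination-0 ℝ (Y ∘ Fin.suc)))
  (+-identityʳ (Y Fin.zero))
  where open RealNumbers ℝ hiding (zero)
combination-unit ℝ Y (Fin.suc i) = trans (+-identityˡ _) (combination-unit ℝ (Y ∘ Fin.suc) i)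
  where open RealNumbers ℝ hiding (zero)

-- Here a, b, d are the n-th powers of 15, 12, 60, p is a power of 5, and u, w are the Lucas or
-- Fibonacci numbers at n and 5 n.
collect-terms : ∀ a b d p u w →
  12 ℕ.* (a ℕ.* (p ℕ.* u)) ℕ.+ (6 ℕ.* (b ℕ.* (p ℕ.* u)) ℕ.+ (12 ℕ.* (d ℕ.* (p ℕ.* u)) ℕ.+ 6 ℕ.* (d ℕ.* (p ℕ.* w)))) ≡
  6 ℕ.* p ℕ.* ((2 ℕ.* a ℕ.+ b ℕ.+ 2 ℕ.* d) ℕ.* u ℕ.+ d ℕ.* w)
collect-terms = solve-∀

-- Evaluation of the Verlinde sum at m = 10.

module VerlindeSum (ℝ : RealNumbers c ℓ₁ ℓ₂ ℓ₃)
  (sin : RealNumbers.Carrier ℝ → RealNumbers.Carrier ℝ) (isSine : IsSine ℝ sin)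
  (π : RealNumbers.Carrier ℝ) (isPi : IsPi ℝ sin π) where

  open RealNumbers ℝ hiding (zero)
  open RealProperties ℝ
  open RealOrder ℝ
  open IsPi isPi
  open Verlinde ℝ sin π isPi
  open IntegerCoefficients commutativeRing
  open Trigonometry ℝ using (sin-multiples; _^ᶜ_; module ℂ)
  open SemiringExp semiring using (^-congˡ; ^-assocʳ)
  open CommutativeSemiringExp (CommutativeRing.commutativeSemiring commutativeRing) using (^-distrib-*)
  open SemiringMult semiring using (×-congʳ; ×-assoc-*)
  open SetoidReasoning (CommutativeRing.setoid commutativeRing)

  θ : Carrier
  θ = π * recip 10

  x y : Carrier
  x = proj₁ (sin-multiples isSine θ)
  y = sin θ

  norm : x * x + y * y ≈ 1#
  norm = proj₁ (proj₂ (sin-multiples isSine θ))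

  open TenthRoot ℝ x y norm

  ^ᶜ≡ReIm : ∀ n → (x , y) ^ᶜ n ≡ (Re n , Im n)
  ^ᶜ≡ReIm zero    = ≡.refl
  ^ᶜ≡ReIm (suc n) = ≡.cong (λ z → (x , y) ℂ.* z) (^ᶜ≡ReIm n)

  sin≈Im : ∀ n {t} → t ≈ fromℕ n * θ → sin t ≈ Im n
  sin≈Im n t≈nθ = trans (proj₂ (proj₂ (sin-multiples isSine θ)) n t≈nθ) (reflexive (≡.cong proj₂ (^ᶜ≡ReIm n)))

  s≈Im : ∀ j → s 10 j ≈ Im (residue j)
  s≈Im j = sin≈Im (residue j)
    (solve 3 (λ π n r → π :* (n :* r) := n :* (π :* r)) refl π (fromℕ (residue j)) (recip 10))

  Im-10≈0 : Im 10 ≈ 0#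
  Im-10≈0 = trans (sym (sin≈Im 10 π≈10θ)) sin-π
    where
    π≈10θ : π ≈ fromℕ 10 * (π * recip 10)
    π≈10θ = begin
      π                           ≈⟨ *-identityʳ π ⟨
      π * 1#                      ≈⟨ *-congˡ (*-⁻¹ (fromℕ 10) (fromℕ-pos 10)) ⟨
      π * (fromℕ 10 * recip 10)
        ≈⟨ solve 3 (λ π n r → π :* (n :* r) := n :* (π :* r)) refl π (fromℕ 10) (recip 10) ⟩
      fromℕ 10 * (π * recip 10)   ∎

  Im-5>0 : 0# < Im 5
  -- Index `4F` carries residue 5, the angle π / 2; likewise `1F` below carries residue 2.
  Im-5>0 = <-respʳ-≈ (s≈Im 4F) (s-pos 10 4F)

  Im-2>0 : 0# < Im 2
  Im-2>0 = <-respʳ-≈ (s≈Im 1F) (s-pos 10 1F)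

  open GoldenAngle Im-10≈0 Im-5>0 Im-2>0

  ⟦4sin²⟧≈ : ∀ j → ⟦ 4sin² (residue j) ⟧ ≈ fromℤ (+ 4) * (s 10 j * s 10 j)
  ⟦4sin²⟧≈ j = trans (⟦4sin²⟧ (residue j)) (*-congˡ (sym (*-cong (s≈Im j) (s≈Im j))))

  -- The constants agree because 4³ = 8².
  ⟦sin²Product⟧ : ∀ j ℓ k → let P = sineProduct 10 j ℓ k in ⟦ sin²Product j ℓ k ⟧ ≈ P * P
  ⟦sin²Product⟧ j ℓ k = begin
    ⟦ a j ⊗ a ℓ ⊗ a k ⟧          ≈⟨ ⟦⟧-⊗ (a j ⊗ a ℓ) (a k) ⟩
    ⟦ a j ⊗ a ℓ ⟧ * ⟦ a k ⟧      ≈⟨ *-congʳ (⟦⟧-⊗ (a j) (a ℓ)) ⟩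
    ⟦ a j ⟧ * ⟦ a ℓ ⟧ * ⟦ a k ⟧  ≈⟨ *-cong (*-cong (⟦4sin²⟧≈ j) (⟦4sin²⟧≈ ℓ)) (⟦4sin²⟧≈ k) ⟩
    fromℤ (+ 4) * (s 10 j * s 10 j) * (fromℤ (+ 4) * (s 10 ℓ * s 10 ℓ)) * (fromℤ (+ 4) * (s 10 k * s 10 k))
      ≈⟨ solve 3 (λ x y z →
           con (+ 4) :* (x :* x) :* (con (+ 4) :* (y :* y)) :* (con (+ 4) :* (z :* z)) :=
           (con (+ 8) :* x :* y :* z) :* (con (+ 8) :* x :* y :* z)) refl (s 10 j) (s 10 ℓ) (s 10 k) ⟩
    (fromℤ (+ 8) * s 10 j * s 10 ℓ * s 10 k) * (fromℤ (+ 8) * s 10 j * s 10 ℓ * s 10 k)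
      ≈⟨ *-cong eight eight ⟨
    P * P ∎
    where
    a : Fin 9 → ℤ[φ]
    a i = 4sin² (residue i)
    P = sineProduct 10 j ℓ k
    eight : P ≈ fromℤ (+ 8) * s 10 j * s 10 ℓ * s 10 k
    eight = *-congʳ (*-congʳ (*-congʳ (fromℕ-fromℤ 8)))

  ⟦⊗^⟧ : ∀ r e → ⟦ r ⊗^ e ⟧ ≈ ⟦ r ⟧ ^ e
  ⟦⊗^⟧ r zero    = trans (⟦n⟧≈fromℕ 1) (+-identityʳ 1#)
  ⟦⊗^⟧ r (suc e) = trans (⟦⟧-⊗ r (r ⊗^ e)) (*-congˡ (⟦⊗^⟧ r e))

  ⟦φ-root⟧ : ∀ e → ⟦ φ-root e ⟧ ≈ φ ^ e * δ
  ⟦φ-root⟧ e = trans (⟦⟧-⊗ (φ̂ ⊗^ e) δ̂) (*-congʳ (trans (⟦⊗^⟧ φ̂ e) (^-congˡ e ⟦φ̂⟧≈φ)))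

  ⟦ψ-root⟧ : ∀ e → ⟦ ψ-root e ⟧ ≈ ψ ^ e * - δ
  ⟦ψ-root⟧ e = trans (⟦⟧-⊗ (ψ̂ ⊗^ e) ((+ 0 , + 0) ⊖ δ̂)) (*-cong (⟦⊗^⟧ ψ̂ e)
    (trans (⟦⟧-⊖ (+ 0 , + 0) δ̂) (trans (+-congʳ (⟦n⟧≈fromℕ 0)) (+-identityˡ (- δ)))))

  module _ (n : ℕ) where

    prefactor : Carrier
    prefactor = fromℕ (3 ℕ.^ n ℕ.* 10 ℕ.^ (2 ℕ.* n))

    prefactor≈300^n : prefactor ≈ fromℕ 300 ^ n
    prefactor≈300^n = begin
      fromℕ (3 ℕ.^ n ℕ.* 10 ℕ.^ (2 ℕ.* n))        ≈⟨ fromℕ-*-homo (3 ℕ.^ n) (10 ℕ.^ (2 ℕ.* n)) ⟩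
      fromℕ (3 ℕ.^ n) * fromℕ (10 ℕ.^ (2 ℕ.* n))  ≈⟨ *-cong (fromℕ-^-homo 3 n) (fromℕ-^-homo 10 (2 ℕ.* n)) ⟩
      fromℕ 3 ^ n * fromℕ 10 ^ (2 ℕ.* n)          ≈⟨ *-congˡ (^-assocʳ (fromℕ 10) 2 n) ⟨
      fromℕ 3 ^ n * (fromℕ 10 ^ 2) ^ n            ≈⟨ ^-distrib-* (fromℕ 3) (fromℕ 10 ^ 2) n ⟨
      (fromℕ 3 * fromℕ 10 ^ 2) ^ n                ≈⟨ ^-congˡ n (*-congˡ (fromℕ-^-homo 10 2)) ⟨
      (fromℕ 3 * fromℕ (10 ℕ.^ 2)) ^ n            ≈⟨ ^-congˡ n (fromℕ-*-homo 3 (10 ℕ.^ 2)) ⟨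
      fromℕ 300 ^ n                               ∎

    Y : Fin 8 → Carrier
    Y i = ⟦ base i ⟧ ^ n

    open LinearCombinations ℝ Y

    inverse : (j ℓ k : Fin 9) → Carrier
    inverse j ℓ k = sineProduct 10 j ℓ k ⁻¹[ sineProduct-pos 10 j ℓ k ]

    -- With u the inverse of P and b the value of `base i`, b P² = 300 yields 300 u² = b; then take
    -- n-th powers.
    summand≈ : ∀ j ℓ k i → base i ⊗ sin²Product j ℓ k ≡ (+ 300 , + 0) →
               prefactor * inverse j ℓ k ^ (2 ℕ.* n) ≈ Y i
    summand≈ j ℓ k i eq = begin
      prefactor * u ^ (2 ℕ.* n)          ≈⟨ *-cong prefactor≈300^n (sym (^-assocʳ u 2 n)) ⟩
      fromℕ 300 ^ n * (u ^ 2) ^ n        ≈⟨ ^-distrib-* (fromℕ 300) (u ^ 2) n ⟨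
      (fromℕ 300 * u ^ 2) ^ n            ≈⟨ ^-congˡ n 300u²≈b ⟩
      ⟦ base i ⟧ ^ n                     ∎
      where
      u = inverse j ℓ k
      P = sineProduct 10 j ℓ k
      b = ⟦ base i ⟧
      bP²≈300 : b * (P * P) ≈ fromℕ 300
      bP²≈300 = begin
        b * (P * P)                      ≈⟨ *-congˡ (⟦sin²Product⟧ j ℓ k) ⟨
        b * ⟦ sin²Product j ℓ k ⟧        ≈⟨ ⟦⟧-⊗ (base i) (sin²Product j ℓ k) ⟨
        ⟦ base i ⊗ sin²Product j ℓ k ⟧   ≡⟨ ≡.cong ⟦_⟧ eq ⟩
        ⟦ + 300 , + 0 ⟧                  ≈⟨ ⟦n⟧≈fromℕ 300 ⟩
        fromℕ 300                        ∎
      Pu≈1 : P * u ≈ 1#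
      Pu≈1 = *-⁻¹ P (sineProduct-pos 10 j ℓ k)
      300u²≈b : fromℕ 300 * u ^ 2 ≈ b
      300u²≈b = begin
        fromℕ 300 * u ^ 2                ≈⟨ *-congʳ bP²≈300 ⟨
        b * (P * P) * u ^ 2
          ≈⟨ solve 3 (λ b P u → b :* (P :* P) :* u :^ 2 := b :* ((P :* u) :* (P :* u))) refl b P u ⟩
        b * ((P * u) * (P * u))          ≈⟨ *-congˡ (trans (*-cong Pu≈1 Pu≈1) (*-identityˡ 1#)) ⟩
        b * 1#                           ≈⟨ *-identityʳ b ⟩
        b                                ∎

    -- One split on an arbitrary decision reduces the condition in the sum and the condition in the
    -- count together.
    choose : ∀ {p} {A : Set p} (A? : Dec A) t i → (A → prefactor * t ≈ Y i) →
             prefactor * (if does A? then t else 0#) ≈ combination (if does A? then unit i else λ _ → 0)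
    choose (yes a) t i eq = trans (eq a) (sym (combination-unit ℝ Y i))
    choose (no _)  t i eq = trans (zeroʳ prefactor) (sym combination-0)

    weight : (j ℓ k : Fin 9) → Fin 8 → ℕ
    weight j ℓ k = if does (admissible? j ℓ k) then unit (class j ℓ k) else λ _ → 0

    summand : (j ℓ k : Fin 9) → Carrier
    summand j ℓ k = if does (admissible? j ℓ k) then inverse j ℓ k ^ (2 ℕ.* n) else 0#

    V≈combination : V n 10 ≈ combination multiplicity
    V≈combination = scaled-triple-sum prefactor summand weight λ j ℓ k →
      choose (admissible? j ℓ k) (inverse j ℓ k ^ (2 ℕ.* n)) (class j ℓ k)
        λ a → summand≈ j ℓ k (class j ℓ k) (class-correct j ℓ k a)

    -- Conjugate bases are adjacent and share the multiplicity k, so pairs can be peeled off the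
    -- front of the eight-term sum, leaving the remainder r.
    Y-pair : ∀ {i i′ m e} → base i ≡ (+ m , + 0) ⊗ φ-root e → base i′ ≡ (+ m , + 0) ⊗ ψ-root e →
             ∀ k r → k · Y i + (k · Y i′ + r) ≈ fromℕ k * (fromℕ (m ℕ.^ n) * conjugatePowers e n) + r
    Y-pair {i} {i′} {m} {e} base-i base-i′ k r = begin
      k · Y i + (k · Y i′ + r)                        ≈⟨ +-assoc _ _ _ ⟨
      k · Y i + k · Y i′ + r                          ≈⟨ +-congʳ (+-cong (·≈fromℕ* (Y i)) (·≈fromℕ* (Y i′))) ⟩
      fromℕ k * Y i + fromℕ k * Y i′ + r              ≈⟨ +-congʳ (distribˡ (fromℕ k) (Y i) (Y i′)) ⟨
      fromℕ k * (Y i + Y i′) + r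
        ≈⟨ +-congʳ (*-congˡ (+-cong (Y≈ i (φ-root e) base-i (⟦φ-root⟧ e)) (Y≈ i′ (ψ-root e) base-i′ (⟦ψ-root⟧ e)))) ⟩
      fromℕ k * (fromℕ (m ℕ.^ n) * (φ ^ e * δ) ^ n + fromℕ (m ℕ.^ n) * (ψ ^ e * - δ) ^ n) + r
        ≈⟨ +-congʳ (*-congˡ (distribˡ (fromℕ (m ℕ.^ n)) _ _)) ⟨
      fromℕ k * (fromℕ (m ℕ.^ n) * conjugatePowers e n) + r ∎
      where
      ·≈fromℕ* : ∀ x → k · x ≈ fromℕ k * x
      ·≈fromℕ* x = trans (×-congʳ k (sym (*-identityˡ x))) (sym (×-assoc-* k 1# x))
      Y≈ : ∀ i {x} r → base i ≡ (+ m , + 0) ⊗ r → ⟦ r ⟧ ≈ x → Y i ≈ fromℕ (m ℕ.^ n) * x ^ n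
      Y≈ i {x} r base-i ⟦r⟧≈x = begin
        ⟦ base i ⟧ ^ n               ≡⟨ ≡.cong (λ b → ⟦ b ⟧ ^ n) base-i ⟩
        ⟦ (+ m , + 0) ⊗ r ⟧ ^ n      ≈⟨ ^-congˡ n (trans (⟦⟧-⊗ (+ m , + 0) r) (*-cong (⟦n⟧≈fromℕ m) ⟦r⟧≈x)) ⟩
        (fromℕ m * x) ^ n            ≈⟨ ^-distrib-* (fromℕ m) x n ⟩
        fromℕ m ^ n * x ^ n          ≈⟨ *-congʳ (fromℕ-^-homo m n) ⟨
        fromℕ (m ℕ.^ n) * x ^ n      ∎

    contribution : ∀ k m e p u → conjugatePowers e n ≈ fromℕ p * fromℕ u →
                   fromℕ k * (fromℕ (m ℕ.^ n) * conjugatePowers e n) ≈ fromℕ (k ℕ.* (m ℕ.^ n ℕ.* (p ℕ.* u)))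
    contribution k m e p u eq = sym (begin
      fromℕ (k ℕ.* (m ℕ.^ n ℕ.* (p ℕ.* u)))            ≈⟨ fromℕ-*-homo k _ ⟩
      fromℕ k * fromℕ (m ℕ.^ n ℕ.* (p ℕ.* u))          ≈⟨ *-congˡ (fromℕ-*-homo (m ℕ.^ n) (p ℕ.* u)) ⟩
      fromℕ k * (fromℕ (m ℕ.^ n) * fromℕ (p ℕ.* u))    ≈⟨ *-congˡ (*-congˡ (trans eq (sym (fromℕ-*-homo p u)))) ⟨
      fromℕ k * (fromℕ (m ℕ.^ n) * conjugatePowers e n) ∎)

    closedForm : ℕ → ℕ → ℕ → ℕ
    closedForm p u w =
      6 ℕ.* p ℕ.* ((2 ℕ.* 15 ℕ.^ n ℕ.+ 12 ℕ.^ n ℕ.+ 2 ℕ.* 60 ℕ.^ n) ℕ.* u ℕ.+ 60 ℕ.^ n ℕ.* w)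

    -- Common to both parities, which differ only in how the two `conjugatePowers` factor.
    V≈closedForm : ∀ p u w → conjugatePowers 1 n ≈ fromℕ p * fromℕ u → conjugatePowers 5 n ≈ fromℕ p * fromℕ w →
                   V n 10 ≈ fromℕ (closedForm p u w)
    V≈closedForm p u w CP₁ CP₅ = begin
      V n 10                    ≈⟨ V≈combination ⟩
      combination multiplicity  ≈⟨ combination-cong multiplicities ⟩
      combination table         ≈⟨ Y-pair {0F} {1F} {15} {1} ≡.refl ≡.refl 12 _ ⟩
      a + _                     ≈⟨ +-congˡ (Y-pair {2F} {3F} {12} {1} ≡.refl ≡.refl 6 _) ⟩
      a + (b + _)               ≈⟨ +-congˡ (+-congˡ (Y-pair {4F} {5F} {60} {1} ≡.refl ≡.refl 12 _)) ⟩
      a + (b + (d + _))         ≈⟨ +-congˡ (+-congˡ (+-congˡ (Y-pair {6F} {7F} {60} {5} ≡.refl ≡.refl 6 0#))) ⟩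
      a + (b + (d + (e + 0#)))
        ≈⟨ +-cong (contribution 12 15 1 p u CP₁) (+-cong (contribution 6 12 1 p u CP₁)
             (+-cong (contribution 12 60 1 p u CP₁) (trans (+-identityʳ e) (contribution 6 60 5 p w CP₅)))) ⟩
      fromℕ a′ + (fromℕ b′ + (fromℕ d′ + fromℕ e′))
        ≈⟨ trans (fromℕ-+-homo a′ (b′ ℕ.+ (d′ ℕ.+ e′))) (+-congˡ (trans (fromℕ-+-homo b′ (d′ ℕ.+ e′))
             (+-congˡ (fromℕ-+-homo d′ e′)))) ⟨
      fromℕ (a′ ℕ.+ (b′ ℕ.+ (d′ ℕ.+ e′)))
        ≡⟨ ≡.cong fromℕ (collect-terms (15 ℕ.^ n) (12 ℕ.^ n) (60 ℕ.^ n) p u w) ⟩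
      fromℕ (closedForm p u w)  ∎
      where
      a = fromℕ 12 * (fromℕ (15 ℕ.^ n) * conjugatePowers 1 n)
      b = fromℕ 6 * (fromℕ (12 ℕ.^ n) * conjugatePowers 1 n)
      d = fromℕ 12 * (fromℕ (60 ℕ.^ n) * conjugatePowers 1 n)
      e = fromℕ 6 * (fromℕ (60 ℕ.^ n) * conjugatePowers 5 n)
      a′ = 12 ℕ.* (15 ℕ.^ n ℕ.* (p ℕ.* u))
      b′ = 6 ℕ.* (12 ℕ.^ n ℕ.* (p ℕ.* u))
      d′ = 12 ℕ.* (60 ℕ.^ n ℕ.* (p ℕ.* u))
      e′ = 6 ℕ.* (60 ℕ.^ n ℕ.* (p ℕ.* w))

  V-even : ∀ k → let n = 2 ℕ.* k in V n 10 ≈ fromℕ (closedForm n (5 ℕ.^ k) (L n) (L (5 ℕ.* n)))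
  V-even k = V≈closedForm n (5 ℕ.^ k) (L n) (L (5 ℕ.* n))
    (trans (conjugatePowers-even 1 k)
      (*-congˡ (reflexive (≡.cong (λ m → fromℕ (L m)) (ℕ.*-identityˡ n)))))
    (conjugatePowers-even 5 k)
    where n = 2 ℕ.* k

  V-odd : ∀ k → let n = suc (2 ℕ.* k) in V n 10 ≈ fromℕ (closedForm n (5 ℕ.^ suc k) (F n) (F (5 ℕ.* n)))
  V-odd k = V≈closedForm n (5 ℕ.^ suc k) (F n) (F (5 ℕ.* n))
    (trans (conjugatePowers-odd 1 k)
      (*-congˡ (reflexive (≡.cong (λ m → fromℕ (F m)) (ℕ.*-identityˡ n)))))
    (conjugatePowers-odd 5 k)
    where n = suc (2 ℕ.* k)

-- The two parities of n and the exponents of 5.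

parity : ∀ n → ∃ λ k → n ≡ 2 ℕ.* k ⊎ n ≡ suc (2 ℕ.* k)
parity zero    = 0 , inj₁ ≡.refl
parity (suc n) = next (parity n)
  where
  next : (∃ λ k → n ≡ 2 ℕ.* k ⊎ n ≡ suc (2 ℕ.* k)) → ∃ λ k → suc n ≡ 2 ℕ.* k ⊎ suc n ≡ suc (2 ℕ.* k)
  next (k , inj₁ n≡2k)   = k , inj₂ (≡.cong suc n≡2k)
  next (k , inj₂ n≡2k+1) = suc k , inj₁ (≡.trans (≡.cong suc n≡2k+1) (≡.sym (ℕ.*-suc 2 k)))

2k/2≡k : ∀ k → 2 ℕ.* k ℕ./ 2 ≡ k
2k/2≡k k = ≡.trans (≡.cong (ℕ._/ 2) (ℕ.*-comm 2 k)) (ℕ.m*n/n≡m k 2)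

2k+2/2≡k+1 : ∀ k → (suc (2 ℕ.* k) ℕ.+ 1) ℕ./ 2 ≡ suc k
2k+2/2≡k+1 k = ≡.trans (≡.cong (ℕ._/ 2) 2k+2≡2[k+1]) (2k/2≡k (suc k))
  where
  2k+2≡2[k+1] : suc (2 ℕ.* k) ℕ.+ 1 ≡ 2 ℕ.* suc k
  2k+2≡2[k+1] = ≡.trans (ℕ.+-comm (suc (2 ℕ.* k)) 1) (≡.sym (ℕ.*-suc 2 k))

2∤2k+1 : ∀ k → 2 ∤ suc (2 ℕ.* k)
2∤2k+1 k 2∣ with () ← ∣1⇒≡1 (∣m+n∣m⇒∣n (≡.subst (2 ∣_) (ℕ.+-comm 1 (2 ℕ.* k)) 2∣) (m∣m*n k))

open import Data.Nat.Base using (_+_; _*_; _^_; _/_; _≤_)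

mainTheorem7 : ∀ {c ℓ₁ ℓ₂ ℓ₃} (ℝ : RealNumbers c ℓ₁ ℓ₂ ℓ₃) →
    let module R = RealNumbers ℝ in
    (sin : R.Carrier → R.Carrier) → IsSine ℝ sin →
    (π : R.Carrier) (isPi : IsPi ℝ sin π) →
    let open Verlinde ℝ sin π isPi using (V) in
    (n : ℕ) → 1 ≤ n →
    (2 ∣ n → V n 10 R.≈ R.fromℕ (6 * 5 ^ (n / 2) *
    ((2 * 15 ^ n + 12 ^ n + 2 * 60 ^ n) * L n + 60 ^ n * L (5 * n)))) ×
    (2 ∤ n → V n 10 R.≈ R.fromℕ (6 * 5 ^ ((n + 1) / 2) *
    ((2 * 15 ^ n + 12 ^ n + 2 * 60 ^ n) * F n + 60 ^ n * F (5 * n))))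
mainTheorem7 ℝ sin isSine π isPi n _ = byParity (parity n)
  where
  open RealNumbers ℝ using (_≈_; fromℕ)
  open Verlinde ℝ sin π isPi using (V)
  open VerlindeSum ℝ sin isSine π isPi

  Claim : (ℕ → ℕ) → ℕ → ℕ → Set _
  Claim f p n = V n 10 ≈ fromℕ (closedForm n p (f n) (f (5 ℕ.* n)))

  byParity : (∃ λ k → n ≡ 2 ℕ.* k ⊎ n ≡ suc (2 ℕ.* k)) →
             (2 ∣ n → Claim L (5 ℕ.^ (n ℕ./ 2)) n) × (2 ∤ n → Claim F (5 ℕ.^ ((n ℕ.+ 1) ℕ./ 2)) n)
  byParity (k , inj₁ n≡2k) =
    (λ _ → ≡.subst (λ n → Claim L (5 ℕ.^ (n ℕ./ 2)) n) (≡.sym n≡2k)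
             (≡.subst (λ j → Claim L (5 ℕ.^ j) (2 ℕ.* k)) (≡.sym (2k/2≡k k)) (V-even k))) ,
    (λ 2∤n → ⊥-elim (2∤n (≡.subst (2 ∣_) (≡.sym n≡2k) (m∣m*n k))))
  byParity (k , inj₂ n≡2k+1) =
    (λ 2∣n → ⊥-elim (2∤2k+1 k (≡.subst (2 ∣_) n≡2k+1 2∣n))) ,
    (λ _ → ≡.subst (λ n → Claim F (5 ℕ.^ ((n ℕ.+ 1) ℕ./ 2)) n) (≡.sym n≡2k+1)
             (≡.subst (λ j → Claim F (5 ℕ.^ j) (suc (2 ℕ.* k))) (≡.sym (2k+2/2≡k+1 k)) (V-odd k)))
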